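{- Let $H$ be a fixed non-matching graph with $e(H)\ge 3$ and let $\ell$ be an integer. If $e(H)\le\ell\le (e(H)-1)^{e(H)/(e(H)-2)}$, then $\lambda(H,\ell)=\log(e(H)-1)$.
   Context: All graphs are finite and simple; $v(G)$, $e(G)$ denote numbers of vertices and edges. $H$ has no isolated vertices (isolated vertices play no role and are deleted). $H$ is non-matching if it contains two adjacent edges. Logarithms are natural. $[s]=\{1,\dots,s\}$. Copies of graphs are not required to be induced. An $\ell$-palette template on $K_n$ is a map $\mathcal P:E(K_n)\to 2^{[\ell]}\setminus\{\emptyset\}$. A finite family of sets $A_1,\dots,A_q$ has a system of distinct representatives (SDR) if there are pairwise distinct $a_i\in A_i$. The template $\mathcal P$ is $H$-SDR-free if on every copy of $H$ in $K_n$ the palettes assigned to its edges have no SDR. Let $\operatorname{ex}_{\log}(n;H,\ell)$ be the maximum of $\sum_{e\in E(K_n)}\log|\mathcal P(e)|$ over all $H$-SDR-free $\ell$-palette templates $\mathcal P$ on $K_n$, and define $$\lambda(H,\ell)=\inf_{n\ge v(H)}\frac{\operatorname{ex}_{\log}(n;H,\ell)}{\binom n2}.$$ -}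

module Defs where

open import Data.Empty using (⊥-elim-irr)
open import Data.Fin as Fin using (Fin)
import Data.Fin.Properties as Fin
open import Data.Fin.Subset using (Subset; _∈_; Nonempty; ∣_∣)
open import Data.Integer as ℤ using (+_)
import Data.Integer.Properties as ℤ
open import Data.List using (List; []; _∷_; length; mapMaybe; foldr; map; allFin; cartesianProduct)
open import Data.Maybe using (Maybe; just; nothing)
open import Data.Nat as ℕ using (ℕ; zero; suc)
open import Data.Nat.Combinatorics using (_C_)
import Data.Nat.Properties as ℕ
open import Data.Product using (Σ; Σ-syntax; ∃-syntax; _×_; _,_; proj₁; proj₂)
open import Data.Rational.Unnormalised as ℚ using (ℚᵘ; 0ℚᵘ; mkℚᵘ; *≤*; *<*; *≡*)
import Data.Rational.Unnormalised.Properties as ℚ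
open import Algebra.Bundles using (CommutativeMonoid)
open import Algebra.Properties.CommutativeSemigroup (CommutativeMonoid.commutativeSemigroup ℚ.+-0-commutativeMonoid) using (interchange)
open import Data.Sum using (inj₁; inj₂)
open import Function.Definitions using (Injective)
open import Level using (0ℓ)
open import Relation.Binary using (Rel; Decidable; Symmetric; Irreflexive; tri<; tri≈; tri>)
open import Relation.Binary.PropositionalEquality
open import Relation.Nullary using (¬_; Dec; yes; no; ¬?)

-- Real numbers: Cauchy sequences of rationals, compared up to _≈_.

record ℝ : Set where
  constructor mkℝ
  field
    seq    : ℕ → ℚᵘ
    cauchy : ∀ ε → 0ℚᵘ ℚ.< ε →
             Σ[ N ∈ ℕ ] ∀ m n → N ℕ.≤ m → N ℕ.≤ n →
             ℚ.∣ seq m ℚ.- seq n ∣ ℚ.≤ ε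

open ℝ public

infix 4 _≈_ _≤_

_≈_ : ℝ → ℝ → Set
x ≈ y = ∀ ε → 0ℚᵘ ℚ.< ε →
        Σ[ N ∈ ℕ ] ∀ n → N ℕ.≤ n → ℚ.∣ seq x n ℚ.- seq y n ∣ ℚ.≤ ε

_≤_ : ℝ → ℝ → Set
x ≤ y = ∀ ε → 0ℚᵘ ℚ.< ε →
        Σ[ N ∈ ℕ ] ∀ n → N ℕ.≤ n → seq x n ℚ.≤ seq y n ℚ.+ ε

≤+⇒-≤ : ∀ {p q r} → p ℚ.≤ q ℚ.+ r → p ℚ.- q ℚ.≤ r
≤+⇒-≤ {p} {q} {r} h = begin
  p ℚ.- q              ≤⟨ ℚ.+-monoˡ-≤ (ℚ.- q) h ⟩
  (q ℚ.+ r) ℚ.- q      ≃⟨ ℚ.+-congˡ (ℚ.- q) (ℚ.+-comm q r) ⟩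
  (r ℚ.+ q) ℚ.- q      ≃⟨ ℚ.+-assoc r q (ℚ.- q) ⟩
  r ℚ.+ (q ℚ.- q)      ≃⟨ ℚ.+-congʳ r (ℚ.+-inverseʳ q) ⟩
  r ℚ.+ 0ℚᵘ            ≃⟨ ℚ.+-identityʳ r ⟩
  r                    ∎
  where open ℚ.≤-Reasoning

-‿swap : ∀ p q → ℚ.- (p ℚ.- q) ℚ.≃ q ℚ.- p
-‿swap p q = begin
  ℚ.- (p ℚ.- q)            ≈⟨ ℚ.≃-reflexive (ℚ.neg-distrib-+ p (ℚ.- q)) ⟩
  ℚ.- p ℚ.+ ℚ.- (ℚ.- q)    ≈⟨ ℚ.+-congʳ (ℚ.- p) (ℚ.neg-involutive q) ⟩
  ℚ.- p ℚ.+ q              ≈⟨ ℚ.+-comm (ℚ.- p) q ⟩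
  q ℚ.- p                  ∎
  where open import Relation.Binary.Reasoning.Setoid ℚ.≃-setoid

∣-∣≤ : ∀ {p q r} → p ℚ.≤ q ℚ.+ r → q ℚ.≤ p ℚ.+ r → ℚ.∣ p ℚ.- q ∣ ℚ.≤ r
∣-∣≤ {p} {q} {r} h h′ with ℚ.∣p∣≡p∨∣p∣≡-p (p ℚ.- q)
... | inj₁ e = subst (ℚ._≤ r) (sym e) (≤+⇒-≤ {p} {q} {r} h)
... | inj₂ e = subst (ℚ._≤ r) (sym e)
                 (ℚ.≤-trans (ℚ.≤-reflexive (-‿swap p q)) (≤+⇒-≤ {q} {p} {r} h′))

archimedes : ∀ ε → 0ℚᵘ ℚ.< ε → Σ[ N ∈ ℕ ] ∀ n → N ℕ.≤ n → + 1 ℚ./ suc n ℚ.≤ ε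
archimedes (mkℚᵘ (+ zero) d) (*<* (ℤ.+<+ ()))
archimedes (mkℚᵘ (+ suc p) d) _ = d , λ n d≤n → *≤* (begin
  + (1 ℕ.* suc d)        ≤⟨ ℤ.+≤+ (ℕ.*-mono-≤ (ℕ.s≤s (ℕ.z≤n {p})) (ℕ.s≤s d≤n)) ⟩
  + (suc p ℕ.* suc n)    ≡⟨ ℤ.pos-* (suc p) (suc n) ⟩
  + suc p ℤ.* + suc n    ∎)
  where open ℤ.≤-Reasoning
archimedes (mkℚᵘ (ℤ.-[1+ p ]) d) (*<* ())

-- If x m ≤ x n + 1/(n+1) for all m and n, then (x n) is a Cauchy sequence.
limit : (x : ℕ → ℚᵘ) → (∀ m n → x m ℚ.≤ x n ℚ.+ (+ 1 ℚ./ suc n)) → ℝ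
limit x h .seq = x
limit x h .cauchy ε ε>0 with archimedes ε ε>0
... | N , small = N , λ m n N≤m N≤n → ∣-∣≤ {x m} {x n}
      (ℚ.≤-trans (h m n) (ℚ.+-monoʳ-≤ (x n) (small n N≤n)))
      (ℚ.≤-trans (h n m) (ℚ.+-monoʳ-≤ (x m) (small m N≤m)))

fromℚ : ℚᵘ → ℝ
fromℚ q = limit (λ _ → q) λ _ n → ℚ.≤-trans
  (ℚ.≤-reflexive (ℚ.≃-sym (ℚ.+-identityʳ q)))
  (ℚ.+-monoʳ-≤ q (*≤* (ℤ.+≤+ ℕ.z≤n)))

fromℕ : ℕ → ℝ
fromℕ k = fromℚ (+ k ℚ./ 1)

0ℝ 1ℝ : ℝ
0ℝ = fromℕ 0
1ℝ = fromℕ 1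

infixl 6 _+_
_+_ : ℝ → ℝ → ℝ
(x + y) .seq n = seq x n ℚ.+ seq y n
(x + y) .cauchy ε ε>0
  with cauchy x (ℚ.½ ℚ.* ε) (half>0 ε ε>0) | cauchy y (ℚ.½ ℚ.* ε) (half>0 ε ε>0)
  where
  half>0 : ∀ ε → 0ℚᵘ ℚ.< ε → 0ℚᵘ ℚ.< ℚ.½ ℚ.* ε
  half>0 ε ε>0 = ℚ.<-respˡ-≃ (ℚ.*-zeroʳ ℚ.½) (ℚ.*-monoʳ-<-pos ℚ.½ ε>0)
... | M , hx | N , hy = M ℕ.⊔ N , λ m n l l′ → begin
    ℚ.∣ (seq x m ℚ.+ seq y m) ℚ.- (seq x n ℚ.+ seq y n) ∣
      ≃⟨ ℚ.∣-∣-cong (shuffle (seq x m) (seq y m) (seq x n) (seq y n)) ⟩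
    ℚ.∣ (seq x m ℚ.- seq x n) ℚ.+ (seq y m ℚ.- seq y n) ∣
      ≤⟨ ℚ.∣p+q∣≤∣p∣+∣q∣ (seq x m ℚ.- seq x n) (seq y m ℚ.- seq y n) ⟩
    ℚ.∣ seq x m ℚ.- seq x n ∣ ℚ.+ ℚ.∣ seq y m ℚ.- seq y n ∣
      ≤⟨ ℚ.+-mono-≤ (hx m n (ℕ.m⊔n≤o⇒m≤o M N l) (ℕ.m⊔n≤o⇒m≤o M N l′))
                    (hy m n (ℕ.m⊔n≤o⇒n≤o M N l) (ℕ.m⊔n≤o⇒n≤o M N l′)) ⟩
    ℚ.½ ℚ.* ε ℚ.+ ℚ.½ ℚ.* ε
      ≃⟨ ℚ.≃-sym (ℚ.*-distribʳ-+ ε ℚ.½ ℚ.½) ⟩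
    (ℚ.½ ℚ.+ ℚ.½) ℚ.* ε
      ≃⟨ ℚ.*-cong {ℚ.½ ℚ.+ ℚ.½} {ℚ.1ℚᵘ} {ε} {ε} (*≡* refl) ℚ.≃-refl ⟩
    ℚ.1ℚᵘ ℚ.* ε
      ≃⟨ ℚ.*-identityˡ ε ⟩
    ε ∎
  where
  open ℚ.≤-Reasoning
  shuffle : ∀ a b c d → (a ℚ.+ b) ℚ.- (c ℚ.+ d) ℚ.≃ (a ℚ.- c) ℚ.+ (b ℚ.- d)
  shuffle a b c d = ℚ.≃-trans
    (ℚ.+-congʳ (a ℚ.+ b) (ℚ.≃-reflexive (ℚ.neg-distrib-+ c d)))
    (interchange a b (ℚ.- c) (ℚ.- d))

-- Division by a natural number, with the convention x ÷ 0 = 0.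
infixl 7 _÷_
_÷_ : ℝ → ℕ → ℝ
x ÷ zero = 0ℝ
(x ÷ suc k) .seq n = seq x n ℚ.* (+ 1 ℚ./ suc k)
(x ÷ suc k) .cauchy ε ε>0 with cauchy x ε ε>0
... | N , h = N , λ m n l l′ → begin
    ℚ.∣ seq x m ℚ.* c ℚ.- seq x n ℚ.* c ∣
      ≃⟨ ℚ.∣-∣-cong (factor (seq x m) (seq x n)) ⟩
    ℚ.∣ (seq x m ℚ.- seq x n) ℚ.* c ∣
      ≃⟨ ℚ.∣p*q∣≃∣p∣*∣q∣ (seq x m ℚ.- seq x n) c ⟩
    ℚ.∣ seq x m ℚ.- seq x n ∣ ℚ.* c
      ≤⟨ ℚ.*-monoʳ-≤-nonNeg ℚ.∣ seq x m ℚ.- seq x n ∣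
           {{ℚ.∣-∣-nonNeg (seq x m ℚ.- seq x n)}} c≤1 ⟩
    ℚ.∣ seq x m ℚ.- seq x n ∣ ℚ.* ℚ.1ℚᵘ
      ≃⟨ ℚ.*-identityʳ ℚ.∣ seq x m ℚ.- seq x n ∣ ⟩
    ℚ.∣ seq x m ℚ.- seq x n ∣
      ≤⟨ h m n l l′ ⟩
    ε ∎
  where
  open ℚ.≤-Reasoning
  c : ℚᵘ
  c = + 1 ℚ./ suc k
  c≤1 : c ℚ.≤ ℚ.1ℚᵘ
  c≤1 = *≤* (ℤ.+≤+ (ℕ.s≤s ℕ.z≤n))
  factor : ∀ p q → p ℚ.* c ℚ.- q ℚ.* c ℚ.≃ (p ℚ.- q) ℚ.* c
  factor p q = ℚ.≃-trans (ℚ.+-congʳ (p ℚ.* c) (ℚ.neg-distribˡ-* q c))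
                         (ℚ.≃-sym (ℚ.*-distribʳ-+ c p (ℚ.- q)))

IsMaximum : {I : Set} → (I → ℝ) → ℝ → Set
IsMaximum f x = (∃[ i ] f i ≈ x) × (∀ i → f i ≤ x)

IsInfimum : {I : Set} → (I → ℝ) → ℝ → Set
IsInfimum f x = (∀ i → x ≤ f i) × (∀ z → (∀ i → z ≤ f i) → z ≤ x)

-- The natural logarithm of a positive integer m, as ∫₁ᵐ dt/t.

-- recipSum a k = 1/(a+1) + ... + 1/(a+k)
recipSum : ℕ → ℕ → ℚᵘ
recipSum a zero    = 0ℚᵘ
recipSum a (suc k) = recipSum a k ℚ.+ (+ 1 ℚ./ suc (a ℕ.+ k))

frac-≤ : ∀ a b c d → a ℕ.* suc d ℕ.≤ c ℕ.* suc b → + a ℚ./ suc b ℚ.≤ + c ℚ./ suc d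
frac-≤ a b c d h = *≤* (subst₂ ℤ._≤_ (ℤ.pos-* a (suc d)) (ℤ.pos-* c (suc b)) (ℤ.+≤+ h))

frac-≃ : ∀ a b c d → a ℕ.* suc d ≡ c ℕ.* suc b → + a ℚ./ suc b ℚ.≃ + c ℚ./ suc d
frac-≃ a b c d h = *≡* (trans (sym (ℤ.pos-* a (suc d))) (trans (cong +_ h) (ℤ.pos-* c (suc b))))

frac-suc : ∀ j d → (+ j ℚ./ suc d) ℚ.+ (+ 1 ℚ./ suc d) ℚ.≃ + suc j ℚ./ suc d
frac-suc j d = *≡* (begin
  (+ j ℤ.* + suc d ℤ.+ + 1 ℤ.* + suc d) ℤ.* + suc d
    ≡⟨ cong (ℤ._* + suc d) (sym (ℤ.*-distribʳ-+ (+ suc d) (+ j) (+ 1))) ⟩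
  ((+ j ℤ.+ + 1) ℤ.* + suc d) ℤ.* + suc d
    ≡⟨ ℤ.*-assoc (+ j ℤ.+ + 1) (+ suc d) (+ suc d) ⟩
  (+ j ℤ.+ + 1) ℤ.* (+ suc d ℤ.* + suc d)
    ≡⟨ cong (ℤ._* (+ suc d ℤ.* + suc d)) (cong +_ (ℕ.+-comm j 1)) ⟩
  + suc j ℤ.* (+ suc d ℤ.* + suc d) ∎)
  where open ≡-Reasoning

recipSum-+ : ∀ a j k → recipSum a (j ℕ.+ k) ℚ.≃ recipSum a j ℚ.+ recipSum (a ℕ.+ j) k
recipSum-+ a j zero rewrite ℕ.+-identityʳ j = ℚ.≃-sym (ℚ.+-identityʳ (recipSum a j))
recipSum-+ a j (suc k) rewrite ℕ.+-suc j k | sym (ℕ.+-assoc a j k) =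
  ℚ.≃-trans (ℚ.+-congˡ t (recipSum-+ a j k))
            (ℚ.+-assoc (recipSum a j) (recipSum (a ℕ.+ j) k) t)
  where
  t : ℚᵘ
  t = + 1 ℚ./ suc (a ℕ.+ j ℕ.+ k)

block-≥ : ∀ c j d → c ℕ.+ j ℕ.≤ suc d → + j ℚ./ suc d ℚ.≤ recipSum c j
block-≥ c zero d h = *≤* ℤ.≤-refl
block-≥ c (suc j) d h rewrite ℕ.+-suc c j = ℚ.≤-trans
  (ℚ.≤-reflexive (ℚ.≃-sym (frac-suc j d)))
  (ℚ.+-mono-≤ (block-≥ c j d (ℕ.≤-trans (ℕ.n≤1+n _) h))
              (frac-≤ 1 d 1 (c ℕ.+ j) (ℕ.*-monoʳ-≤ 1 h)))

block-≤ : ∀ c j → recipSum (suc c) j ℚ.≤ + j ℚ./ suc c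
block-≤ c zero = *≤* ℤ.≤-refl
block-≤ c (suc j) = ℚ.≤-trans
  (ℚ.+-mono-≤ (block-≤ c j)
              (frac-≤ 1 (suc (c ℕ.+ j)) 1 c
                (ℕ.*-monoʳ-≤ 1 (ℕ.s≤s (ℕ.≤-trans (ℕ.m≤m+n c j) (ℕ.n≤1+n _))))))
  (ℚ.≤-reflexive (frac-suc j c))

refine-≥ : ∀ B a k → recipSum a k ℚ.≤ recipSum (a ℕ.* suc B) (k ℕ.* suc B)
refine-≥ B a zero = ℚ.≤-refl
refine-≥ B a (suc k) = begin
  recipSum a k ℚ.+ (+ 1 ℚ./ suc (a ℕ.+ k))
    ≃⟨ ℚ.+-congʳ (recipSum a k) (frac-≃ 1 (a ℕ.+ k) b d eq) ⟩
  recipSum a k ℚ.+ (+ b ℚ./ suc d)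
    ≤⟨ ℚ.+-mono-≤ (refine-≥ B a k) (block-≥ (a ℕ.* b ℕ.+ k ℕ.* b) b d (ℕ.≤-reflexive eq′)) ⟩
  recipSum (a ℕ.* b) (k ℕ.* b) ℚ.+ recipSum (a ℕ.* b ℕ.+ k ℕ.* b) b
    ≃⟨ ℚ.≃-sym (recipSum-+ (a ℕ.* b) (k ℕ.* b) b) ⟩
  recipSum (a ℕ.* b) (k ℕ.* b ℕ.+ b)
    ≡⟨ cong (recipSum (a ℕ.* b)) (ℕ.+-comm (k ℕ.* b) b) ⟩
  recipSum (a ℕ.* b) (suc k ℕ.* b) ∎
  where
  open ℚ.≤-Reasoning
  b d : ℕ
  b = suc B
  d = B ℕ.+ (a ℕ.+ k) ℕ.* b
  eq : 1 ℕ.* suc d ≡ b ℕ.* suc (a ℕ.+ k)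
  eq = trans (ℕ.*-identityˡ (suc d)) (ℕ.*-comm (suc (a ℕ.+ k)) b)
  eq′ : a ℕ.* b ℕ.+ k ℕ.* b ℕ.+ b ≡ suc d
  eq′ = trans (cong (ℕ._+ b) (sym (ℕ.*-distribʳ-+ b a k))) (ℕ.+-comm ((a ℕ.+ k) ℕ.* b) b)

refine-≤ : ∀ A a k → recipSum (suc a ℕ.* suc A) (k ℕ.* suc A) ℚ.+ (+ 1 ℚ./ suc (a ℕ.+ k))
                     ℚ.≤ recipSum (suc a) k ℚ.+ (+ 1 ℚ./ suc a)
refine-≤ A a zero = ℚ.+-monoʳ-≤ 0ℚᵘ
  (ℚ.≤-reflexive (ℚ.≃-reflexive (cong (mkℚᵘ (+ 1)) (ℕ.+-identityʳ a))))
refine-≤ A a (suc k) = begin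
  recipSum (suc a ℕ.* b) (suc k ℕ.* b) ℚ.+ (+ 1 ℚ./ suc (a ℕ.+ suc k))
    ≡⟨ cong (λ j → recipSum (suc a ℕ.* b) (suc k ℕ.* b) ℚ.+ mkℚᵘ (+ 1) j) (ℕ.+-suc a k) ⟩
  recipSum (suc a ℕ.* b) (suc k ℕ.* b) ℚ.+ t′
    ≡⟨ cong (λ j → recipSum (suc a ℕ.* b) j ℚ.+ t′) (ℕ.+-comm b (k ℕ.* b)) ⟩
  recipSum (suc a ℕ.* b) (k ℕ.* b ℕ.+ b) ℚ.+ t′
    ≃⟨ ℚ.+-congˡ t′ (recipSum-+ (suc a ℕ.* b) (k ℕ.* b) b) ⟩
  (R ℚ.+ recipSum (suc a ℕ.* b ℕ.+ k ℕ.* b) b) ℚ.+ t′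
    ≤⟨ ℚ.+-monoˡ-≤ t′ (ℚ.+-monoʳ-≤ R step) ⟩
  (R ℚ.+ t) ℚ.+ t′
    ≤⟨ ℚ.+-monoˡ-≤ t′ (refine-≤ A a k) ⟩
  (r ℚ.+ u) ℚ.+ t′
    ≃⟨ ℚ.+-assoc r u t′ ⟩
  r ℚ.+ (u ℚ.+ t′)
    ≃⟨ ℚ.+-congʳ r (ℚ.+-comm u t′) ⟩
  r ℚ.+ (t′ ℚ.+ u)
    ≃⟨ ℚ.≃-sym (ℚ.+-assoc r t′ u) ⟩
  (r ℚ.+ t′) ℚ.+ u ∎
  where
  open ℚ.≤-Reasoning
  b d : ℕ
  b = suc A
  d = A ℕ.+ (a ℕ.+ k) ℕ.* b
  R r t t′ u : ℚᵘ
  R = recipSum (suc a ℕ.* b) (k ℕ.* b)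
  r = recipSum (suc a) k
  t = + 1 ℚ./ suc (a ℕ.+ k)
  t′ = + 1 ℚ./ suc (suc (a ℕ.+ k))
  u = + 1 ℚ./ suc a
  step : recipSum (suc a ℕ.* b ℕ.+ k ℕ.* b) b ℚ.≤ t
  step = subst (λ c → recipSum c b ℚ.≤ t) (ℕ.*-distribʳ-+ b (suc a) k)
    (ℚ.≤-trans (block-≤ d b) (frac-≤ b d 1 (a ℕ.+ k)
      (ℕ.≤-reflexive (trans (ℕ.*-comm b (suc (a ℕ.+ k))) (sym (ℕ.*-identityˡ (suc d)))))))

log-modulus : ∀ p m n → recipSum (suc m) (p ℕ.* suc m)
                        ℚ.≤ recipSum (suc n) (p ℕ.* suc n) ℚ.+ (+ 1 ℚ./ suc n)
log-modulus p m n = begin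
  recipSum (suc m) (p ℕ.* suc m)
    ≤⟨ refine-≥ n (suc m) (p ℕ.* suc m) ⟩
  recipSum (suc m ℕ.* suc n) (p ℕ.* suc m ℕ.* suc n)
    ≡⟨ cong₂ recipSum (ℕ.*-comm (suc m) (suc n)) swap ⟩
  recipSum (suc n ℕ.* suc m) (p ℕ.* suc n ℕ.* suc m)
    ≤⟨ ℚ.p≤p+q (recipSum (suc n ℕ.* suc m) (p ℕ.* suc n ℕ.* suc m)) (+ 1 ℚ./ suc (n ℕ.+ p ℕ.* suc n)) ⟩
  recipSum (suc n ℕ.* suc m) (p ℕ.* suc n ℕ.* suc m) ℚ.+ (+ 1 ℚ./ suc (n ℕ.+ p ℕ.* suc n))
    ≤⟨ refine-≤ m n (p ℕ.* suc n) ⟩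
  recipSum (suc n) (p ℕ.* suc n) ℚ.+ (+ 1 ℚ./ suc n) ∎
  where
  open ℚ.≤-Reasoning
  swap : p ℕ.* suc m ℕ.* suc n ≡ p ℕ.* suc n ℕ.* suc m
  swap = trans (ℕ.*-assoc p (suc m) (suc n))
        (trans (cong (p ℕ.*_) (ℕ.*-comm (suc m) (suc n))) (sym (ℕ.*-assoc p (suc n) (suc m))))

-- The n-th term is the right Riemann sum of 1/t over [1, m] with mesh 1/(n+1);
-- multiplying numerator and denominator by 1/(n+1), it is the sum of 1/i over
-- n+1 < i ≤ m(n+1).  Convention: log 0 = 0.
log : ℕ → ℝ
log zero    = 0ℝ
log (suc p) = limit (λ n → recipSum (suc n) (p ℕ.* suc n)) (log-modulus p)

-- The largest j ≤ b with j ^ r ≤ x (for r ≥ 1).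
searchRoot : (r x b : ℕ) → ℕ
searchRoot r x zero    = zero
searchRoot r x (suc b) with suc b ℕ.^ r ℕ.≤? x
... | yes _ = suc b
... | no  _ = searchRoot r x b

-- ⌊ x ^ (1/r) ⌋ for r ≥ 1.
floorRoot : ℕ → ℕ → ℕ
floorRoot r x = searchRoot r x x

root-lower : ∀ r x b → searchRoot (suc r) x b ℕ.^ suc r ℕ.≤ x
root-lower r x zero = ℕ.z≤n
root-lower r x (suc b) with suc b ℕ.^ suc r ℕ.≤? x
... | yes h = h
... | no  _ = root-lower r x b

root-upper : ∀ r x b → x ℕ.< suc b ℕ.^ suc r → x ℕ.< suc (searchRoot (suc r) x b) ℕ.^ suc r
root-upper r x zero h = h
root-upper r x (suc b) h with suc b ℕ.^ suc r ℕ.≤? x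
... | yes _  = h
... | no  b≰ = root-upper r x b (ℕ.≰⇒> b≰)

^-reflects-< : ∀ r a b → a ℕ.^ r ℕ.< b ℕ.^ r → a ℕ.< b
^-reflects-< r a b h with a ℕ.<? b
... | yes a<b = a<b
... | no  a≮b = ⊥-elim-irr (ℕ.<⇒≱ h (ℕ.^-monoˡ-≤ r (ℕ.≮⇒≥ a≮b)))

^-distribʳ-* : ∀ r a b → (a ℕ.* b) ℕ.^ r ≡ a ℕ.^ r ℕ.* b ℕ.^ r
^-distribʳ-* zero    a b = refl
^-distribʳ-* (suc r) a b = trans (cong (a ℕ.* b ℕ.*_) (^-distribʳ-* r a b))
                                 (ℕ.[m*n]*[o*p]≡[m*o]*[n*p] a b (a ℕ.^ r) (b ℕ.^ r))

power-modulus : ∀ X r m n →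
  + floorRoot (suc r) (X ℕ.* suc m ℕ.^ suc r) ℚ./ suc m
    ℚ.≤ (+ floorRoot (suc r) (X ℕ.* suc n ℕ.^ suc r) ℚ./ suc n) ℚ.+ (+ 1 ℚ./ suc n)
power-modulus X r m n = ℚ.≤-trans
  (frac-≤ i m (suc j) n (ℕ.<⇒≤ (^-reflects-< (suc r) (i ℕ.* suc n) (suc j ℕ.* suc m) (begin-strict
    (i ℕ.* suc n) ℕ.^ suc r                    ≡⟨ ^-distribʳ-* (suc r) i (suc n) ⟩
    i ℕ.^ suc r ℕ.* N                          ≤⟨ ℕ.*-monoˡ-≤ N (root-lower r (X ℕ.* M) (X ℕ.* M)) ⟩
    X ℕ.* M ℕ.* N                              ≡⟨ ℕ.*-assoc X M N ⟩
    X ℕ.* (M ℕ.* N)                            ≡⟨ cong (X ℕ.*_) (ℕ.*-comm M N) ⟩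
    X ℕ.* (N ℕ.* M)                            ≡⟨ ℕ.*-assoc X N M ⟨
    X ℕ.* N ℕ.* M                              <⟨ ℕ.*-monoˡ-< M {{ℕ.m^n≢0 (suc m) (suc r)}}
                                                    (root-upper r (X ℕ.* N) (X ℕ.* N) big) ⟩
    suc j ℕ.^ suc r ℕ.* M                      ≡⟨ ^-distribʳ-* (suc r) (suc j) (suc m) ⟨
    (suc j ℕ.* suc m) ℕ.^ suc r                ∎))))
  (ℚ.≤-reflexive (ℚ.≃-sym (frac-suc j n)))
  where
  open ℕ.≤-Reasoning
  M N i j : ℕ
  M = suc m ℕ.^ suc r
  N = suc n ℕ.^ suc r
  i = floorRoot (suc r) (X ℕ.* M)
  j = floorRoot (suc r) (X ℕ.* N)
  big : X ℕ.* N ℕ.< suc (X ℕ.* N) ℕ.^ suc r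
  big = ℕ.m≤m*n (suc (X ℕ.* N)) (suc (X ℕ.* N) ℕ.^ r) {{ℕ.m^n≢0 (suc (X ℕ.* N)) r}}

-- power a p r = a^(p/r), the r-th root of a^p; its n-th term is the largest
-- fraction j/(n+1) with (j/(n+1))^r ≤ a^p.  By convention p/0 = 0, so power a p 0 = 1.
power : ℕ → ℕ → ℕ → ℝ
power a p zero    = 1ℝ
power a p (suc r) = limit
  (λ n → + floorRoot (suc r) (a ℕ.^ p ℕ.* suc n ℕ.^ suc r) ℚ./ suc n)
  (power-modulus (a ℕ.^ p) r)

record Graph : Set₁ where
  field
    v      : ℕ
    Adj    : Rel (Fin v) 0ℓ
    adj?   : Decidable Adj
    adjSym : Symmetric Adj
    adjIrr : Irreflexive _≡_ Adj

open Graph public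

-- An edge is stored with its smaller endpoint first.  The proofs are
-- irrelevant, so edges with the same endpoints are equal.
record Edge (G : Graph) : Set where
  constructor edge
  field
    lo hi     : Fin (v G)
    .lo<hi    : lo Fin.< hi
    .adjacent : Adj G lo hi

open Edge public using (lo; hi)

edges : (G : Graph) → List (Edge G)
edges G = mapMaybe toEdge (cartesianProduct (allFin (v G)) (allFin (v G)))
  where
  toEdge : Fin (v G) × Fin (v G) → Maybe (Edge G)
  toEdge (x , y) with x Fin.<? y | adj? G x y
  ... | yes x<y | yes xy = just (edge x y x<y xy)
  ... | _       | _      = nothing

e : Graph → ℕ
e G = length (edges G)

NoIsolatedVertices : Graph → Set
NoIsolatedVertices G = ∀ x → ∃[ y ] Adj G x y

-- Two distinct edges xy and xz share the vertex x.
NonMatching : Graph → Set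
NonMatching G = ∃[ x ] ∃[ y ] ∃[ z ] y ≢ z × Adj G x y × Adj G x z

K : ℕ → Graph
K n .v = n
K n .Adj = _≢_
K n .adj? x y = ¬? (x Fin.≟ y)
K n .adjSym = ≢-sym
K n .adjIrr x≡y x≢y = x≢y x≡y

joinK : ∀ {n} (x y : Fin n) → .(x ≢ y) → Edge (K n)
joinK x y x≢y with Fin.<-cmp x y
... | tri< x<y _ _ = edge x y x<y x≢y
... | tri≈ _ x≡y _ = ⊥-elim-irr (x≢y x≡y)
... | tri> _ _ y<x = edge y x y<x (≢-sym x≢y)

-- A copy of H in Kₙ, given by a placement of the vertices of H.
record Copy (H : Graph) (n : ℕ) : Set where
  field
    place    : Fin (v H) → Fin n
    distinct : Injective _≡_ _≡_ place

  onEdge : Edge H → Edge (K n)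
  onEdge (edge x y x<y _) =
    joinK (place x) (place y) (λ eq → Fin.<⇒≢ x<y (distinct eq))

open Copy public

record Template (n ℓ : ℕ) : Set where
  field
    palette  : Edge (K n) → Subset ℓ
    nonempty : ∀ f → Nonempty (palette f)

open Template public

HasSDR : {I : Set} {ℓ : ℕ} → (I → Subset ℓ) → Set
HasSDR {I} {ℓ} A = Σ[ a ∈ (I → Fin ℓ) ] (∀ i → a i ∈ A i) × Injective _≡_ _≡_ a

SDRFree : (H : Graph) {n ℓ : ℕ} → Template n ℓ → Set
SDRFree H {n} P = (c : Copy H n) → ¬ HasSDR (λ f → palette P (onEdge c f))

logWeight : {n ℓ : ℕ} → Template n ℓ → ℝ
logWeight {n} P = foldr _+_ 0ℝ (map (λ f → log ∣ palette P f ∣) (edges (K n)))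

IsExLog : (n : ℕ) (H : Graph) (ℓ : ℕ) → ℝ → Set
IsExLog n H ℓ = IsMaximum {Σ[ P ∈ Template n ℓ ] SDRFree H P} (λ (P , _) → logWeight P)

-- λ(H,ℓ) = x: the maxima exₙ = ex_log(n;H,ℓ) exist for all n ≥ v(H), and x is
-- the infimum of exₙ / (n choose 2) over these n.
IsLambda : Graph → ℕ → ℝ → Set
IsLambda H ℓ x = Σ[ ex ∈ (ℕ → ℝ) ]
  (∀ n → v H ℕ.≤ n → IsExLog n H ℓ (ex n)) ×
  IsInfimum {Σ[ n ∈ ℕ ] v H ℕ.≤ n} (λ (n , _) → ex n ÷ (n C 2)) x

{-# OPTIONS --safe #-}
module Submission where

-- Let d = e(H) - 1. The template assigning the same d colours to every edge has no SDR on
-- any copy of H, and it is optimal for every n ≥ v(H), so no limit is involved. Indeed, if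
-- the palettes on a copy of H have no SDR, then choosing representatives greedily in order
-- of size gets stuck, so for some 1 ≤ k ≤ d there are k+1 palettes of size at most k, and
-- the product of all sizes is at most k^(k+1) ℓ^(d-k). The hypothesis on ℓ makes this at
-- most d^(d+1) at k = 1, it is an equality at k = d, and in between log-convexity in k
-- gives the same bound. Multiplying over all permutations of the vertices of Kₙ, every
-- edge is counted equally often, so the product of all palette sizes is at most d^(n C 2).

open import Defs
open import Data.Nat as ℕ using (ℕ; zero; suc; _∸_)
import Data.Nat.Properties as ℕ
open import Data.Nat.Combinatorics using (_C_; nC1≡n; nCk+nC[k+1]≡[n+1]C[k+1])
open import Data.Nat.ListAction using (product)
open import Data.Nat.ListAction.Properties using (product-↭; product≢0)
open import Data.Nat.Solver using (module +-*-Solver)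
open +-*-Solver using (solve; _:=_; _:+_; _:*_; con)
open import Data.Integer as ℤ using (+_)
import Data.Integer.Properties as ℤ
open import Data.Rational.Unnormalised as ℚ using (ℚᵘ; 0ℚᵘ)
import Data.Rational.Unnormalised.Properties as ℚ
open import Algebra.Bundles using (CommutativeMonoid)
open import Algebra.Properties.CommutativeSemigroup (CommutativeMonoid.commutativeSemigroup ℚ.+-0-commutativeMonoid) using (interchange)
open import Data.Empty using (⊥-elim-irr)
open import Data.Fin as Fin using (Fin; zero; suc)
import Data.Fin.Properties as Fin
open import Data.Fin.Permutation as Perm using (Permutation′; _⟨$⟩ʳ_; _⟨$⟩ˡ_; _∘ₚ_)
open import Data.Fin.Subset as Subset using (Subset; Nonempty; ∣_∣; inside; outside; ⁅_⁆; _∪_; _⊆_; ⊥)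
import Data.Fin.Subset.Properties as Subset
open import Data.List as List using (List; []; _∷_; _++_; length; map; mapMaybe; foldr; allFin; cartesianProduct; cartesianProductWith)
import Data.List.Properties as List
open import Data.List.Membership.DecPropositional using (_∈?_)
open import Data.List.Membership.Propositional using (_∈_; _∉_; lose)
open import Data.List.Membership.Propositional.Properties
  using (∈-map⁺; ∈-map⁻; ∈-++⁺ˡ; ∈-++⁺ʳ; ∈-allFin; ∈-cartesianProduct⁺; ∈-cartesianProductWith⁺)
open import Data.List.Membership.Propositional.Properties.WithK using (unique∧set⇒bag)
open import Data.List.Relation.Binary.BagAndSetEquality using (∼bag⇒↭)
open import Data.List.Relation.Binary.Permutation.Propositional using (_↭_; ↭-sym; ↭⇒↭ₛ)
import Data.List.Relation.Binary.Permutation.Propositional.Properties as ↭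
open import Data.List.Relation.Binary.Permutation.Setoid.Properties using (Unique-resp-↭)
open import Data.List.Relation.Unary.All as All using (All; []; _∷_)
import Data.List.Relation.Unary.All.Properties as All
open import Data.List.Relation.Unary.AllPairs using (AllPairs; []; _∷_)
open import Data.List.Relation.Unary.Any using (here; there)
import Data.List.Relation.Unary.Any.Properties as Any
open import Data.List.Relation.Unary.Sorted.TotalOrder.Properties using (Sorted⇒AllPairs)
open import Data.List.Relation.Unary.Unique.Propositional using (Unique)
import Data.List.Relation.Unary.Unique.Propositional.Properties as Unique
open import Data.List.Sort using (sort; sort-↭; sort-↗)
open import Data.Maybe using (Maybe; just; nothing)
import Data.Maybe.Relation.Unary.All as MAll
import Data.Maybe.Relation.Unary.Any as MAny
open import Data.Product using (Σ-syntax; ∃-syntax; _×_; _,_; proj₁; proj₂)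
open import Data.Sum using (_⊎_; inj₁; inj₂)
open import Data.Vec using (Vec; []; _∷_; lookup; tabulate)
import Data.Vec.Properties as Vec
open import Function using (_∘_; mk⇔)
open import Relation.Binary using (DecidableEquality; DecTotalOrder; tri<; tri≈; tri>)
import Relation.Binary.Construct.Flip.EqAndOrd as Flip
import Relation.Binary.Construct.On as On
open import Relation.Binary.PropositionalEquality
open import Relation.Nullary using (yes; no; recompute; contradiction; decidable-stable; ¬_; ¬?)
open import Relation.Nullary.Decidable using (dec-true; dec-false; _×-dec_)

-- Convexity of k ↦ k^(k+1)

-- (1+x)ⁿ (1 - n/(1+x)) ≤ xⁿ, cleared of its denominator.
bernoulli : ∀ x n j → n ℕ.+ j ≡ x → suc x ℕ.^ n ℕ.* suc j ℕ.≤ suc x ℕ.* x ℕ.^ n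
bernoulli x zero j refl = ℕ.≤-reflexive (ℕ.*-comm 1 (suc x))
bernoulli x (suc n) j eq = begin
  suc x ℕ.* p ℕ.* suc j
    ≡⟨ solve 3 (λ x p j → (con 1 :+ x) :* p :* (con 1 :+ j) := p :* ((con 1 :+ j) :+ x :* (con 1 :+ j))) refl x p j ⟩
  p ℕ.* (suc j ℕ.+ x ℕ.* suc j)   ≤⟨ ℕ.*-monoʳ-≤ p (ℕ.+-monoˡ-≤ (x ℕ.* suc j) j<x) ⟩
  p ℕ.* (x ℕ.+ x ℕ.* suc j)
    ≡⟨ solve 3 (λ x p j → p :* (x :+ x :* (con 1 :+ j)) := x :* (p :* (con 2 :+ j))) refl x p j ⟩
  x ℕ.* (p ℕ.* suc (suc j))       ≤⟨ ℕ.*-monoʳ-≤ x (bernoulli x n (suc j) (trans (ℕ.+-suc n j) eq)) ⟩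
  x ℕ.* (suc x ℕ.* x ℕ.^ n)
    ≡⟨ solve 2 (λ x q → x :* ((con 1 :+ x) :* q) := (con 1 :+ x) :* (x :* q)) refl x (x ℕ.^ n) ⟩
  suc x ℕ.* (x ℕ.* x ℕ.^ n)       ∎
  where
  open ℕ.≤-Reasoning
  p : ℕ
  p = suc x ℕ.^ n
  j<x : suc j ℕ.≤ x
  j<x = ℕ.≤-trans (ℕ.s≤s (ℕ.m≤n+m j n)) (ℕ.≤-reflexive eq)

^-cancelˡ-≤ : ∀ r .{{_ : ℕ.NonZero r}} {a b} → a ℕ.^ r ℕ.≤ b ℕ.^ r → a ℕ.≤ b
^-cancelˡ-≤ r h = ℕ.≮⇒≥ (λ b<a → ℕ.<⇒≱ (ℕ.^-monoˡ-< r b<a) h)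

^-comm : ∀ a m n → (a ℕ.^ m) ℕ.^ n ≡ (a ℕ.^ n) ℕ.^ m
^-comm a m n = trans (ℕ.^-*-assoc a m n) (trans (cong (a ℕ.^_) (ℕ.*-comm m n)) (sym (ℕ.^-*-assoc a n m)))

-- Log-convexity of k ↦ k^(k+1) at k = i+2; Bernoulli's inequality is applied with
-- (i+1)(i+3) + 1 = (i+2)².
k^[k+1]-logConvex : ∀ i → let k = suc (suc i) in
  (k ℕ.^ suc k) ℕ.* (k ℕ.^ suc k) ℕ.≤ suc i ℕ.^ k ℕ.* suc k ℕ.^ suc (suc k)
k^[k+1]-logConvex i = ℕ.*-cancelˡ-≤ (k ℕ.* k) (begin
  k ℕ.* k ℕ.* ((k ℕ.* p) ℕ.* (k ℕ.* p))
    ≡⟨ solve 2 (λ k p → k :* k :* ((k :* p) :* (k :* p)) := (p :* p) :* (k :* (k :* k :* k))) refl k p ⟩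
  (p ℕ.* p) ℕ.* (k ℕ.* (k ℕ.* k ℕ.* k))
    ≤⟨ ℕ.*-monoʳ-≤ (p ℕ.* p) (ℕ.*-monoʳ-≤ k cube) ⟩
  (p ℕ.* p) ℕ.* (k ℕ.* (l ℕ.* (m ℕ.* m)))
    ≡⟨ solve 4 (λ p k l m → (p :* p) :* (k :* (l :* (m :* m))) := (p :* p) :* (l :* k) :* (m :* m)) refl p k l m ⟩
  (p ℕ.* p) ℕ.* (l ℕ.* k) ℕ.* (m ℕ.* m)
    ≡⟨ cong (λ t → t ℕ.* (l ℕ.* k) ℕ.* (m ℕ.* m)) (^-distribʳ-* k k k) ⟨
  (k ℕ.* k) ℕ.^ k ℕ.* (l ℕ.* k) ℕ.* (m ℕ.* m)
    ≡⟨ cong (λ t → t ℕ.^ k ℕ.* (l ℕ.* k) ℕ.* (m ℕ.* m)) sq ⟩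
  suc x ℕ.^ k ℕ.* (l ℕ.* k) ℕ.* (m ℕ.* m)
    -- `suc j` computes to `l * k`, and the `suc x` that appears on the right is the factor `k * k`
    -- to be cancelled.
    ≤⟨ ℕ.*-monoˡ-≤ (m ℕ.* m) (bernoulli x k j k+j) ⟩
  suc x ℕ.* x ℕ.^ k ℕ.* (m ℕ.* m)
    ≡⟨ cong₂ (λ s t → s ℕ.* t ℕ.* (m ℕ.* m)) (sym sq) (^-distribʳ-* k l m) ⟩
  k ℕ.* k ℕ.* (q ℕ.* r) ℕ.* (m ℕ.* m)
    ≡⟨ solve 4 (λ k q r m → k :* k :* (q :* r) :* (m :* m) := k :* k :* (q :* (m :* (m :* r)))) refl k q r m ⟩
  k ℕ.* k ℕ.* (q ℕ.* (m ℕ.* (m ℕ.* r))) ∎)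
  where
  open ℕ.≤-Reasoning
  k l m p q r x j : ℕ
  k = suc (suc i)
  l = suc i
  m = suc k
  p = k ℕ.^ k
  q = l ℕ.^ k
  r = m ℕ.^ k
  x = l ℕ.* m
  j = suc i ℕ.+ i ℕ.* k
  sq : k ℕ.* k ≡ suc x
  sq = solve 1 (λ i → (con 2 :+ i) :* (con 2 :+ i) := con 1 :+ (con 1 :+ i) :* (con 3 :+ i)) refl i
  k+j : k ℕ.+ j ≡ x
  k+j = solve 1 (λ i → (con 2 :+ i) :+ (con 1 :+ i :+ i :* (con 2 :+ i)) := (con 1 :+ i) :* (con 3 :+ i)) refl i
  cube : k ℕ.* k ℕ.* k ℕ.≤ l ℕ.* (m ℕ.* m)
  cube = begin
    k ℕ.* k ℕ.* k
      ≤⟨ ℕ.m≤m+n (k ℕ.* k ℕ.* k) (i ℕ.* i ℕ.+ 3 ℕ.* i ℕ.+ 1) ⟩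
    k ℕ.* k ℕ.* k ℕ.+ (i ℕ.* i ℕ.+ 3 ℕ.* i ℕ.+ 1)
      ≡⟨ solve 1 (λ i → (con 2 :+ i) :* (con 2 :+ i) :* (con 2 :+ i) :+ (i :* i :+ con 3 :* i :+ con 1) := (con 1 :+ i) :* ((con 3 :+ i) :* (con 3 :+ i))) refl i ⟩
    l ℕ.* (m ℕ.* m) ∎

-- k^((k+1)/(k-1)) is nondecreasing for k ≥ 2; here k = i+1.
k^[k+1]/[k-1]-step : ∀ i →
  suc i ℕ.^ (suc (suc i) ℕ.* suc i) ℕ.≤ suc (suc i) ℕ.^ ((3 ℕ.+ i) ℕ.* i)
k^[k+1]/[k-1]-step zero = ℕ.≤-refl
-- `u` is the right side of the induction hypothesis. With it the exponents of `m` add up to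
-- 2(m+1)k, which is the k-th power of the left side of log-convexity at `m`.
k^[k+1]/[k-1]-step (suc i) = ℕ.*-cancelˡ-≤ u {{ℕ.m^n≢0 m (suc m ℕ.* i)}} (begin
  u ℕ.* m ℕ.^ (suc m ℕ.* m)
    ≡⟨ ℕ.^-distribˡ-+-* m (suc m ℕ.* i) (suc m ℕ.* m) ⟨
  m ℕ.^ (suc m ℕ.* i ℕ.+ suc m ℕ.* m)
    ≡⟨ cong (m ℕ.^_) (solve 1 (λ i → (con 3 :+ i) :* i :+ (con 3 :+ i) :* (con 2 :+ i)
                                      := ((con 3 :+ i) :+ (con 3 :+ i)) :* (con 1 :+ i)) refl i) ⟩
  m ℕ.^ ((suc m ℕ.+ suc m) ℕ.* k)
    ≡⟨ ℕ.^-*-assoc m (suc m ℕ.+ suc m) k ⟨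
  (m ℕ.^ (suc m ℕ.+ suc m)) ℕ.^ k
    ≡⟨ cong (ℕ._^ k) (ℕ.^-distribˡ-+-* m (suc m) (suc m)) ⟩
  (m ℕ.^ suc m ℕ.* m ℕ.^ suc m) ℕ.^ k
    ≤⟨ ℕ.^-monoˡ-≤ k (k^[k+1]-logConvex i) ⟩
  (k ℕ.^ m ℕ.* suc m ℕ.^ suc (suc m)) ℕ.^ k
    ≡⟨ ^-distribʳ-* k (k ℕ.^ m) (suc m ℕ.^ suc (suc m)) ⟩
  (k ℕ.^ m) ℕ.^ k ℕ.* (suc m ℕ.^ suc (suc m)) ℕ.^ k
    ≡⟨ cong₂ ℕ._*_ (ℕ.^-*-assoc k m k) (ℕ.^-*-assoc (suc m) (suc (suc m)) k) ⟩
  k ℕ.^ (m ℕ.* k) ℕ.* suc m ℕ.^ (suc (suc m) ℕ.* k)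
    ≤⟨ ℕ.*-monoˡ-≤ (suc m ℕ.^ (suc (suc m) ℕ.* k)) (k^[k+1]/[k-1]-step i) ⟩
  u ℕ.* suc m ℕ.^ (suc (suc m) ℕ.* k) ∎)
  where
  open ℕ.≤-Reasoning
  k m u : ℕ
  k = suc i
  m = suc k
  u = m ℕ.^ (suc m ℕ.* i)

-- The denominators k-1 = i and d-1 = b are cleared, so i = 0 is a case of its own, in which the
-- left side is 1. In the induction step, raising to the b-th power makes the exponents of the
-- induction hypothesis and of the single step match.
k^[k+1]/[k-1]-mono : ∀ {i b} → i ℕ.≤′ b →
  suc i ℕ.^ (suc (suc i) ℕ.* b) ℕ.≤ suc b ℕ.^ (suc (suc b) ℕ.* i)
k^[k+1]/[k-1]-mono ℕ.≤′-refl = ℕ.≤-refl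
k^[k+1]/[k-1]-mono {zero} {b} _ =
  ℕ.≤-trans (ℕ.≤-reflexive (ℕ.^-zeroˡ (2 ℕ.* b))) (ℕ.m^n>0 (suc b) (suc (suc b) ℕ.* 0))
k^[k+1]/[k-1]-mono {suc i} {suc zero} (ℕ.≤′-step (ℕ.≤′-reflexive ()))
k^[k+1]/[k-1]-mono {i} {suc b@(suc _)} (ℕ.≤′-step i≤b) = ^-cancelˡ-≤ b (begin
  (suc i ℕ.^ (s ℕ.* suc b)) ℕ.^ b    ≡⟨ cong (ℕ._^ b) (ℕ.^-*-assoc (suc i) s (suc b)) ⟨
  ((suc i ℕ.^ s) ℕ.^ suc b) ℕ.^ b    ≡⟨ ^-comm (suc i ℕ.^ s) (suc b) b ⟩
  ((suc i ℕ.^ s) ℕ.^ b) ℕ.^ suc b    ≡⟨ cong (ℕ._^ suc b) (ℕ.^-*-assoc (suc i) s b) ⟩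
  (suc i ℕ.^ (s ℕ.* b)) ℕ.^ suc b    ≤⟨ ℕ.^-monoˡ-≤ (suc b) (k^[k+1]/[k-1]-mono i≤b) ⟩
  (suc b ℕ.^ (t ℕ.* i)) ℕ.^ suc b    ≡⟨ cong (ℕ._^ suc b) (ℕ.^-*-assoc (suc b) t i) ⟨
  ((suc b ℕ.^ t) ℕ.^ i) ℕ.^ suc b    ≡⟨ ^-comm (suc b ℕ.^ t) i (suc b) ⟩
  ((suc b ℕ.^ t) ℕ.^ suc b) ℕ.^ i    ≡⟨ cong (ℕ._^ i) (ℕ.^-*-assoc (suc b) t (suc b)) ⟩
  (suc b ℕ.^ (t ℕ.* suc b)) ℕ.^ i    ≤⟨ ℕ.^-monoˡ-≤ i (k^[k+1]/[k-1]-step b) ⟩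
  (suc (suc b) ℕ.^ (suc t ℕ.* b)) ℕ.^ i
    ≡⟨ cong (ℕ._^ i) (ℕ.^-*-assoc (suc (suc b)) (suc t) b) ⟨
  ((suc (suc b) ℕ.^ suc t) ℕ.^ b) ℕ.^ i
    ≡⟨ ^-comm (suc (suc b) ℕ.^ suc t) b i ⟩
  ((suc (suc b) ℕ.^ suc t) ℕ.^ i) ℕ.^ b
    ≡⟨ cong (ℕ._^ b) (ℕ.^-*-assoc (suc (suc b)) (suc t) i) ⟩
  (suc (suc b) ℕ.^ (suc t ℕ.* i)) ℕ.^ b ∎)
  where
  open ℕ.≤-Reasoning
  s t : ℕ
  s = suc (suc i)
  t = suc (suc b)

-- With k = i+1 and d = b+1: the log-convex function k ↦ k^(k+1) ℓ^(d-k) is largest at an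
-- endpoint of [1, d]; at k = 1 it is bounded by hypothesis.
k^[k+1]ℓ^[d-k]-bound : ∀ ℓ {i b} .{{_ : ℕ.NonZero b}} → i ℕ.≤ b →
  ℓ ℕ.^ b ℕ.≤ suc b ℕ.^ suc (suc b) →
  suc i ℕ.^ suc (suc i) ℕ.* ℓ ℕ.^ (b ∸ i) ℕ.≤ suc b ℕ.^ suc (suc b)
-- The b-th power clears the weights i/b and c/b of the interpolation: the two factors are bounded
-- by the i-th and the c-th power of d^(d+1).
k^[k+1]ℓ^[d-k]-bound ℓ {i} {b} i≤b h = ^-cancelˡ-≤ b (begin
  (suc i ℕ.^ s ℕ.* ℓ ℕ.^ c) ℕ.^ b              ≡⟨ ^-distribʳ-* b (suc i ℕ.^ s) (ℓ ℕ.^ c) ⟩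
  (suc i ℕ.^ s) ℕ.^ b ℕ.* (ℓ ℕ.^ c) ℕ.^ b      ≡⟨ cong₂ ℕ._*_ (ℕ.^-*-assoc (suc i) s b) (^-comm ℓ c b) ⟩
  suc i ℕ.^ (s ℕ.* b) ℕ.* (ℓ ℕ.^ b) ℕ.^ c
    ≤⟨ ℕ.*-mono-≤ (k^[k+1]/[k-1]-mono (ℕ.≤⇒≤′ i≤b)) (ℕ.^-monoˡ-≤ c h) ⟩
  suc b ℕ.^ (t ℕ.* i) ℕ.* (suc b ℕ.^ t) ℕ.^ c
    ≡⟨ cong (ℕ._* (suc b ℕ.^ t) ℕ.^ c) (ℕ.^-*-assoc (suc b) t i) ⟨
  (suc b ℕ.^ t) ℕ.^ i ℕ.* (suc b ℕ.^ t) ℕ.^ c  ≡⟨ ℕ.^-distribˡ-+-* (suc b ℕ.^ t) i c ⟨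
  (suc b ℕ.^ t) ℕ.^ (i ℕ.+ c)                  ≡⟨ cong ((suc b ℕ.^ t) ℕ.^_) (ℕ.m+[n∸m]≡n i≤b) ⟩
  (suc b ℕ.^ t) ℕ.^ b ∎)
  where
  open ℕ.≤-Reasoning
  c s t : ℕ
  c = b ∸ i
  s = suc (suc i)
  t = suc (suc b)

-- From the real power to an inequality of integers

-- Since x/K = ℓ - 1/K, Bernoulli's inequality gives X ≥ ℓ^R (1 - R/(ℓK)) > ℓ^R - 1 for `K` this
-- large, and both X and ℓ^R are integers.
^-squeeze : ∀ R ℓ X K x .{{_ : ℕ.NonZero ℓ}} .{{_ : ℕ.NonZero K}} →
  R ℕ.* ℓ ℕ.^ R ℕ.< K → ℓ ℕ.* K ≡ suc x → x ℕ.^ R ℕ.≤ X ℕ.* K ℕ.^ R → ℓ ℕ.^ R ℕ.≤ X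
^-squeeze R ℓ X K x K-big eq h = ℕ.≮⇒≥ λ X<ℓ^R → ℕ.<⇒≱ (small X<ℓ^R) large
  where
  open ℕ.≤-Reasoning
  L : ℕ
  L = ℓ ℕ.^ R
  R≤x : R ℕ.≤ x
  R≤x = ℕ.≤-pred (begin-strict
    R            ≤⟨ ℕ.m≤m*n R L {{ℕ.m^n≢0 ℓ R}} ⟩
    R ℕ.* L      <⟨ K-big ⟩
    K            ≤⟨ ℕ.m≤n*m K ℓ ⟩
    ℓ ℕ.* K      ≡⟨ eq ⟩
    suc x        ∎)
  large : L ℕ.* suc (x ∸ R) ℕ.≤ suc x ℕ.* X
  large = ℕ.*-cancelˡ-≤ (K ℕ.^ R) {{ℕ.m^n≢0 K R}} (begin
    K ℕ.^ R ℕ.* (L ℕ.* suc (x ∸ R))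
      ≡⟨ solve 3 (λ p q r → p :* (q :* r) := q :* p :* r) refl (K ℕ.^ R) L (suc (x ∸ R)) ⟩
    L ℕ.* K ℕ.^ R ℕ.* suc (x ∸ R)    ≡⟨ cong (ℕ._* suc (x ∸ R)) (^-distribʳ-* R ℓ K) ⟨
    (ℓ ℕ.* K) ℕ.^ R ℕ.* suc (x ∸ R)  ≡⟨ cong (λ t → t ℕ.^ R ℕ.* suc (x ∸ R)) eq ⟩
    suc x ℕ.^ R ℕ.* suc (x ∸ R)      ≤⟨ bernoulli x R (x ∸ R) (ℕ.m+[n∸m]≡n R≤x) ⟩
    suc x ℕ.* x ℕ.^ R                ≤⟨ ℕ.*-monoʳ-≤ (suc x) h ⟩
    suc x ℕ.* (X ℕ.* K ℕ.^ R)
      ≡⟨ solve 3 (λ p q r → p :* (q :* r) := r :* (p :* q)) refl (suc x) X (K ℕ.^ R) ⟩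
    K ℕ.^ R ℕ.* (suc x ℕ.* X) ∎)
  small : X ℕ.< L → suc x ℕ.* X ℕ.< L ℕ.* suc (x ∸ R)
  small X<L = ℕ.+-cancelʳ-< (suc x) (suc x ℕ.* X) (L ℕ.* suc (x ∸ R)) (begin-strict
    suc x ℕ.* X ℕ.+ suc x
      ≡⟨ solve 2 (λ p q → p :* q :+ p := p :* (con 1 :+ q)) refl (suc x) X ⟩
    suc x ℕ.* suc X                        ≤⟨ ℕ.*-monoʳ-≤ (suc x) X<L ⟩
    suc x ℕ.* L                            ≡⟨ cong (λ t → suc t ℕ.* L) (ℕ.m∸n+n≡m R≤x) ⟨
    suc (x ∸ R ℕ.+ R) ℕ.* L
      ≡⟨ solve 3 (λ p q r → (con 1 :+ (p :+ q)) :* r := r :* (con 1 :+ p) :+ q :* r) refl (x ∸ R) R L ⟩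
    L ℕ.* suc (x ∸ R) ℕ.+ R ℕ.* L          <⟨ ℕ.+-monoʳ-< (L ℕ.* suc (x ∸ R)) K-big ⟩
    L ℕ.* suc (x ∸ R) ℕ.+ K                ≤⟨ ℕ.+-monoʳ-≤ (L ℕ.* suc (x ∸ R)) (ℕ.m≤n*m K ℓ) ⟩
    L ℕ.* suc (x ∸ R) ℕ.+ ℓ ℕ.* K          ≡⟨ cong (L ℕ.* suc (x ∸ R) ℕ.+_) eq ⟩
    L ℕ.* suc (x ∸ R) ℕ.+ suc x            ∎)

-- A single instance of the real inequality suffices: it reads ℓ ≤ j/S + 1/M with j^R ≤ a^p S^R.
-- Clearing denominators gives xS ≤ jM for x = ℓM - 1, the situation of `^-squeeze`.
≤power⇒^≤ : ∀ ℓ a p r → fromℕ ℓ ≤ power a p (suc r) → ℓ ℕ.^ suc r ℕ.≤ a ℕ.^ p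
≤power⇒^≤ zero a p r _ = ℕ.z≤n
≤power⇒^≤ ℓ@(suc ℓ-1) a p r h
  -- The error is 1/M with M = Rℓ^R + 1, just above the threshold in `^-squeeze`.
  with h (ℤ.+ 1 ℚ./ suc (suc r ℕ.* ℓ ℕ.^ suc r)) (ℚ.*<* (ℤ.+<+ ℕ.z<s))
... | N , h′ with h′ N ℕ.≤-refl
... | ℚ.*≤* h″ = ^-squeeze (suc r) ℓ X M x (ℕ.n<1+n _) refl
  (ℕ.*-cancelʳ-≤ (x ℕ.^ R) (X ℕ.* M ℕ.^ R) (S ℕ.^ R) {{ℕ.m^n≢0 S R}} (begin
    x ℕ.^ R ℕ.* S ℕ.^ R          ≡⟨ ^-distribʳ-* R x S ⟨
    (x ℕ.* S) ℕ.^ R              ≤⟨ ℕ.^-monoˡ-≤ R x*S≤j*M ⟩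
    (j ℕ.* M) ℕ.^ R              ≡⟨ ^-distribʳ-* R j M ⟩
    j ℕ.^ R ℕ.* M ℕ.^ R          ≤⟨ ℕ.*-monoˡ-≤ (M ℕ.^ R) (root-lower r (X ℕ.* S ℕ.^ R) (X ℕ.* S ℕ.^ R)) ⟩
    X ℕ.* S ℕ.^ R ℕ.* M ℕ.^ R
      ≡⟨ solve 3 (λ p q r → p :* q :* r := p :* r :* q) refl X (S ℕ.^ R) (M ℕ.^ R) ⟩
    X ℕ.* M ℕ.^ R ℕ.* S ℕ.^ R    ∎))
  where
  open ℕ.≤-Reasoning
  R X M S j x : ℕ
  R = suc r
  X = a ℕ.^ p
  M = suc (R ℕ.* ℓ ℕ.^ R)
  S = suc N
  j = floorRoot R (X ℕ.* S ℕ.^ R)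
  x = R ℕ.* ℓ ℕ.^ R ℕ.+ ℓ-1 ℕ.* M
  inℕ : ℓ ℕ.* (S ℕ.* M) ℕ.≤ (j ℕ.* M ℕ.+ 1 ℕ.* S) ℕ.* 1
  inℕ = ℤ.drop‿+≤+ (subst₂ ℤ._≤_
    (sym (ℤ.pos-* ℓ (S ℕ.* M)))
    (trans (cong (ℤ._* ℤ.+ 1) (cong₂ ℤ._+_ (sym (ℤ.pos-* j M)) (sym (ℤ.pos-* 1 S))))
           (sym (ℤ.pos-* (j ℕ.* M ℕ.+ 1 ℕ.* S) 1)))
    h″)
  x*S≤j*M : x ℕ.* S ℕ.≤ j ℕ.* M
  x*S≤j*M = ℕ.+-cancelʳ-≤ S (x ℕ.* S) (j ℕ.* M) (begin
    x ℕ.* S ℕ.+ S                    ≡⟨ ℕ.+-comm (x ℕ.* S) S ⟩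
    ℓ ℕ.* M ℕ.* S
      ≡⟨ solve 3 (λ p q r → p :* q :* r := p :* (r :* q)) refl ℓ M S ⟩
    ℓ ℕ.* (S ℕ.* M)                  ≤⟨ inℕ ⟩
    (j ℕ.* M ℕ.+ 1 ℕ.* S) ℕ.* 1
      ≡⟨ solve 2 (λ p q → (p :+ con 1 :* q) :* con 1 := p :+ q) refl (j ℕ.* M) S ⟩
    j ℕ.* M ℕ.+ S                    ∎)

-- Double counting over the symmetric group

module _ {A : Set} where

  product-map-* : ∀ (f g : A → ℕ) xs →
    product (map (λ x → f x ℕ.* g x) xs) ≡ product (map f xs) ℕ.* product (map g xs)
  product-map-* f g [] = refl
  product-map-* f g (x ∷ xs) = trans (cong (f x ℕ.* g x ℕ.*_) (product-map-* f g xs))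
    (ℕ.[m*n]*[o*p]≡[m*o]*[n*p] (f x) (g x) (product (map f xs)) (product (map g xs)))

  product-map-const : ∀ c (xs : List A) → product (map (λ _ → c) xs) ≡ c ℕ.^ length xs
  product-map-const c [] = refl
  product-map-const c (x ∷ xs) = cong (c ℕ.*_) (product-map-const c xs)

  product-map≢0 : ∀ (f : A → ℕ) → (∀ x → ℕ.NonZero (f x)) → ∀ xs → ℕ.NonZero (product (map f xs))
  product-map≢0 f f≢0 xs = product≢0 (All.map⁺ (All.universal f≢0 xs))

  product-map-mono : ∀ {f g : A → ℕ} → (∀ x → f x ℕ.≤ g x) → ∀ xs →
    product (map f xs) ℕ.≤ product (map g xs)
  product-map-mono f≤g [] = ℕ.≤-refl
  product-map-mono f≤g (x ∷ xs) = ℕ.*-mono-≤ (f≤g x) (product-map-mono f≤g xs)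

product-map-≤^ : ∀ {A : Set} {f : A → ℕ} {k xs} → All (λ x → f x ℕ.≤ k) xs → product (map f xs) ℕ.≤ k ℕ.^ length xs
product-map-≤^ []       = ℕ.≤-refl
product-map-≤^ (p ∷ ps) = ℕ.*-mono-≤ p (product-map-≤^ ps)

product-map-swap : ∀ {A B : Set} (f : A → B → ℕ) xs ys →
  product (map (λ x → product (map (f x) ys)) xs) ≡
  product (map (λ y → product (map (λ x → f x y) xs)) ys)
product-map-swap f [] ys = sym (trans (product-map-const 1 ys) (ℕ.^-zeroˡ (length ys)))
product-map-swap f (x ∷ xs) ys =
  trans (cong (product (map (f x) ys) ℕ.*_) (product-map-swap f xs ys))
        (sym (product-map-* (f x) (λ y → product (map (λ x → f x y) xs)) ys))

module _ {A : Set} where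

  unique-↭ : ∀ {xs ys : List A} → Unique xs → Unique ys →
    (∀ z → z ∈ xs) → (∀ z → z ∈ ys) → xs ↭ ys
  unique-↭ uxs uys ∈xs ∈ys = ∼bag⇒↭ (unique∧set⇒bag uxs uys (λ {z} → mk⇔ (λ _ → ∈ys z) (λ _ → ∈xs z)))

  -- A bijection only permutes a complete list without repetitions. This is used for translations of
  -- the symmetric group and for its action on edges.
  product-reindex : ∀ {xs} → Unique xs → (∀ z → z ∈ xs) → (φ ψ : A → A) →
    (∀ x → ψ (φ x) ≡ x) → (∀ x → φ (ψ x) ≡ x) → (f : A → ℕ) →
    product (map (f ∘ φ) xs) ≡ product (map f xs)
  product-reindex {xs} uxs ∈xs φ ψ ψφ φψ f = trans (cong product (List.map-∘ xs))
    (product-↭ (↭.map⁺ f (unique-↭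
      (Unique.map⁺ (λ {x} {y} eq → trans (sym (ψφ x)) (trans (cong ψ eq) (ψφ y))) uxs)
      uxs
      (λ z → subst (_∈ map φ xs) (φψ z) (∈-map⁺ φ (∈xs (ψ z))))
      ∈xs)))

-- Complete lists of edges without repetitions

module _ {A B : Set} (f : A → Maybe B) where

  ∈-mapMaybe⁺ : ∀ {x y xs} → f x ≡ just y → x ∈ xs → y ∈ mapMaybe f xs
  ∈-mapMaybe⁺ {x} {y} {xs} fx x∈xs = Any.mapMaybe⁺ f xs
    (lose (∈-map⁺ f x∈xs) (subst (MAny.Any (y ≡_)) (sym fx) (MAny.just refl)))

  -- Injectivity is demanded only where `f` is defined, because `toEdge` and `toPerm` send all
  -- unsuitable pairs to `nothing`.
  mapMaybe-unique : (∀ {x x′ y} → f x ≡ just y → f x′ ≡ just y → x ≡ x′) →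
    ∀ {xs} → Unique xs → Unique (mapMaybe f xs)
  mapMaybe-unique inj [] = []
  mapMaybe-unique inj {x ∷ xs} (x∉ ∷ u) with f x in fx
  ... | nothing = mapMaybe-unique inj u
  ... | just y  = All.mapMaybe⁺ (All.map⁺ (All.map fresh x∉)) ∷ mapMaybe-unique inj u
    where
    fresh : ∀ {x′} → x ≢ x′ → MAll.All (y ≢_) (f x′)
    fresh {x′} x≢x′ with f x′ in fx′
    ... | nothing = MAll.nothing
    ... | just y′ = MAll.just λ { refl → x≢x′ (inj fx fx′) }

private
  -- The function mapped by edges is local to its definition; unification recovers it.
  edges-as-mapMaybe : ∀ G → Σ[ f ∈ (Fin (v G) × Fin (v G) → Maybe (Edge G)) ]
    edges G ≡ mapMaybe f (cartesianProduct (allFin (v G)) (allFin (v G)))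
  edges-as-mapMaybe G = _ , refl

  toEdge : ∀ G → Fin (v G) × Fin (v G) → Maybe (Edge G)
  toEdge G = proj₁ (edges-as-mapMaybe G)

  toEdge-endpoints : ∀ G (f : Edge G) → toEdge G (lo f , hi f) ≡ just f
  toEdge-endpoints G (edge x y x<y xy) with x Fin.<? y | adj? G x y
  ... | yes _   | yes _   = refl
  ... | no  x≮y | _       = ⊥-elim-irr (x≮y x<y)
  ... | yes _   | no  ¬xy = ⊥-elim-irr (¬xy xy)

  endpoints-toEdge : ∀ G {p f} → toEdge G p ≡ just f → p ≡ (lo f , hi f)
  endpoints-toEdge G {x , y} eq with x Fin.<? y | adj? G x y | eq
  ... | yes _ | yes _ | refl = refl

∈-edges : ∀ G (f : Edge G) → f ∈ edges G
∈-edges G f = ∈-mapMaybe⁺ (toEdge G) (toEdge-endpoints G f)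
  (∈-cartesianProduct⁺ (∈-allFin (lo f)) (∈-allFin (hi f)))

edges-unique : ∀ G → Unique (edges G)
edges-unique G = mapMaybe-unique (toEdge G)
  (λ p q → trans (endpoints-toEdge G p) (sym (endpoints-toEdge G q)))
  (Unique.cartesianProduct⁺ (Unique.allFin⁺ (v G)) (Unique.allFin⁺ (v G)))

private
  sucEdge : ∀ {n} → Edge (K n) → Edge (K (suc n))
  sucEdge (edge x y x<y x≢y) = edge (suc x) (suc y) (ℕ.s<s x<y) (x≢y ∘ Fin.suc-injective)

  zeroEdge : ∀ {n} → Fin n → Edge (K (suc n))
  zeroEdge y = edge zero (suc y) ℕ.z<s (λ ())

  -- A second enumeration, recursive in `n`: first the edges at vertex `zero`, then the others. Its
  -- length obeys Pascal's rule, and it is a permutation of `edges (K n)`.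
  edgesK : ∀ n → List (Edge (K n))
  edgesK zero    = []
  edgesK (suc n) = map zeroEdge (allFin n) ++ map sucEdge (edgesK n)

  ∈-edgesK : ∀ n f → f ∈ edgesK n
  ∈-edgesK (suc n) (edge _ zero x<y _)          = ⊥-elim-irr (ℕ.n≮0 x<y)
  ∈-edgesK (suc n) (edge zero (suc y) _ _)      = ∈-++⁺ˡ (∈-map⁺ zeroEdge (∈-allFin y))
  ∈-edgesK (suc n) (edge (suc x) (suc y) x<y x≢y) =
    ∈-++⁺ʳ (map zeroEdge (allFin n)) (∈-map⁺ sucEdge (∈-edgesK n (edge x y (ℕ.s<s⁻¹ x<y) (x≢y ∘ cong suc))))

  edgesK-unique : ∀ n → Unique (edgesK n)
  edgesK-unique zero    = []
  edgesK-unique (suc n) = Unique.++⁺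
    (Unique.map⁺ (λ { refl → refl }) (Unique.allFin⁺ n))
    (Unique.map⁺ (λ { refl → refl }) (edgesK-unique n))
    λ (p , q) → disjoint (∈-map⁻ zeroEdge p) (∈-map⁻ sucEdge q)
    where
    disjoint : ∀ {f} → ∃[ y ] (y ∈ allFin n × f ≡ zeroEdge y) → ¬ (∃[ g ] (g ∈ edgesK n × f ≡ sucEdge g))
    disjoint (_ , _ , refl) (_ , _ , ())

  length-edgesK : ∀ n → length (edgesK n) ≡ n C 2
  length-edgesK zero    = refl
  length-edgesK (suc n) = begin
    length (map zeroEdge (allFin n) ++ map sucEdge (edgesK n))
      ≡⟨ List.length-++ (map zeroEdge (allFin n)) ⟩
    length (map zeroEdge (allFin n)) ℕ.+ length (map sucEdge (edgesK n))
      ≡⟨ cong₂ ℕ._+_ (List.length-map zeroEdge (allFin n)) (List.length-map sucEdge (edgesK n)) ⟩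
    length (allFin n) ℕ.+ length (edgesK n)
      ≡⟨ cong₂ ℕ._+_ (trans (List.length-tabulate {n = n} (λ i → i)) (sym (nC1≡n n))) (length-edgesK n) ⟩
    n C 1 ℕ.+ n C 2
      ≡⟨ nCk+nC[k+1]≡[n+1]C[k+1] n 1 ⟩
    suc n C 2 ∎
    where open ≡-Reasoning

e-K : ∀ n → e (K n) ≡ n C 2
e-K n = trans
  (↭.↭-length (unique-↭ (edges-unique (K n)) (edgesK-unique n) (∈-edges (K n)) (∈-edgesK n)))
  (length-edgesK n)

-- Composition of copies in complete graphs

joinK-< : ∀ {n} {x y : Fin n} .(x≢y : x ≢ y) (x<y : x Fin.< y) → joinK x y x≢y ≡ edge x y x<y x≢y
joinK-< {x = x} {y} x≢y x<y with Fin.<-cmp x y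
... | tri< _ _ _   = refl
... | tri≈ x≮y _ _ = contradiction x<y x≮y
... | tri> x≮y _ _ = contradiction x<y x≮y

joinK-> : ∀ {n} {x y : Fin n} .(x≢y : x ≢ y) (y<x : y Fin.< x) → joinK x y x≢y ≡ edge y x y<x (≢-sym x≢y)
joinK-> {x = x} {y} x≢y y<x with Fin.<-cmp x y
... | tri< _ _ y≮x = contradiction y<x y≮x
... | tri≈ _ _ y≮x = contradiction y<x y≮x
... | tri> _ _ _   = refl

joinK-cong : ∀ {n} {x x′ y y′ : Fin n} .(x≢y : x ≢ y) .(x′≢y′ : x′ ≢ y′) →
  x ≡ x′ → y ≡ y′ → joinK x y x≢y ≡ joinK x′ y′ x′≢y′
joinK-cong _ _ refl refl = refl

joinK-comm : ∀ {n} (x y : Fin n) .(x≢y : x ≢ y) → joinK x y x≢y ≡ joinK y x (≢-sym x≢y)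
joinK-comm x y x≢y with Fin.<-cmp x y
... | tri< x<y _ _ = sym (joinK-> (≢-sym x≢y) x<y)
... | tri≈ _ x≡y _ = ⊥-elim-irr (x≢y x≡y)
... | tri> _ _ y<x = sym (joinK-< (≢-sym x≢y) y<x)

infixr 9 _∘ᶜ_
_∘ᶜ_ : ∀ {H n m} → Copy (K n) m → Copy H n → Copy H m
(b ∘ᶜ c) .place    = place b ∘ place c
(b ∘ᶜ c) .distinct = distinct c ∘ distinct b

-- The inner copy may reverse the order of the endpoints. Then the two sides join the same vertices
-- in opposite orders, and `joinK-comm` identifies them.
onEdge-∘ : ∀ {H n m} (b : Copy (K n) m) (c : Copy H n) f → onEdge (b ∘ᶜ c) f ≡ onEdge b (onEdge c f)
onEdge-∘ b c (edge x y x<y _) = lemma (λ eq → Fin.<⇒≢ x<y (distinct c eq))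
  where
  lemma : ∀ {x y} .(x≢y : x ≢ y) → joinK (place b x) (place b y) (λ eq → x≢y (distinct b eq)) ≡ onEdge b (joinK x y x≢y)
  lemma {x} {y} x≢y with Fin.<-cmp x y
  ... | tri< _ _ _   = refl
  ... | tri≈ _ x≡y _ = ⊥-elim-irr (x≢y x≡y)
  ... | tri> _ _ _   = joinK-comm (place b x) (place b y) (λ eq → x≢y (distinct b eq))

onEdge-≡ : ∀ {H m} (c : Copy H m) f (g : Edge (K m)) →
  place c (lo f) ≡ lo g → place c (hi f) ≡ hi g → onEdge c f ≡ g
onEdge-≡ c (edge x y x<y xy) (edge x′ y′ x′<y′ x′≢y′) p q = begin
  onEdge c (edge x y x<y xy)   ≡⟨ joinK-cong (λ eq → Fin.<⇒≢ x<y (distinct c eq)) x′≢y′ p q ⟩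
  joinK x′ y′ x′≢y′           ≡⟨ joinK-< x′≢y′ (recompute (x′ Fin.<? y′) x′<y′) ⟩
  edge x′ y′ x′<y′ x′≢y′      ∎
  where open ≡-Reasoning

-- The symmetric group and its action on edges

-- Permutations of Fin n with decidable, proof-irrelevant equality, so that they can be listed.
record Permutation (n : ℕ) : Set where
  constructor perm
  field
    to from   : Vec (Fin n) n
    .to∘from  : ∀ x → lookup to (lookup from x) ≡ x
    .from∘to  : ∀ x → lookup from (lookup to x) ≡ x

open Permutation using (to; from)

from-to : ∀ {n} (π : Permutation n) x → lookup (from π) (lookup (to π) x) ≡ x
from-to (perm t f tf ft) x = recompute (_ Fin.≟ x) (ft x)

to-from : ∀ {n} (π : Permutation n) x → lookup (to π) (lookup (from π) x) ≡ x
to-from (perm t f tf ft) x = recompute (_ Fin.≟ x) (tf x)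

copy : ∀ {n} → Permutation n → Copy (K n) n
copy π .place = lookup (to π)
copy π .distinct {x} {y} eq = trans (sym (from-to π x)) (trans (cong (lookup (from π)) eq) (from-to π y))

lookup-injective : ∀ {A : Set} {n} {xs ys : Vec A n} → (∀ i → lookup xs i ≡ lookup ys i) → xs ≡ ys
lookup-injective {xs = xs} {ys} eq =
  trans (sym (Vec.tabulate∘lookup xs)) (trans (Vec.tabulate-cong eq) (Vec.tabulate∘lookup ys))

perm-cong : ∀ {n} {π σ : Permutation n} → to π ≡ to σ → from π ≡ from σ → π ≡ σ
perm-cong refl refl = refl

fromPermutation′ : ∀ {n} → Permutation′ n → Permutation n
fromPermutation′ π = perm (tabulate (π ⟨$⟩ʳ_)) (tabulate (π ⟨$⟩ˡ_))
  (λ x → trans (Vec.lookup∘tabulate (π ⟨$⟩ʳ_) _) (trans (cong (π ⟨$⟩ʳ_) (Vec.lookup∘tabulate (π ⟨$⟩ˡ_) x)) (Perm.inverseʳ π)))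
  (λ x → trans (Vec.lookup∘tabulate (π ⟨$⟩ˡ_) _) (trans (cong (π ⟨$⟩ˡ_) (Vec.lookup∘tabulate (π ⟨$⟩ʳ_) x)) (Perm.inverseˡ π)))

infixl 8 _⊙_
_⊙_ : ∀ {n} → Permutation n → Permutation n → Permutation n
perm t f tf ft ⊙ perm t′ f′ tf′ ft′ = perm (tabulate (lookup t ∘ lookup t′)) (tabulate (lookup f′ ∘ lookup f))
  (λ x → trans (Vec.lookup∘tabulate (lookup t ∘ lookup t′) _)
    (trans (cong (lookup t ∘ lookup t′) (Vec.lookup∘tabulate (lookup f′ ∘ lookup f) x))
    (trans (cong (lookup t) (tf′ (lookup f x))) (tf x))))
  (λ x → trans (Vec.lookup∘tabulate (lookup f′ ∘ lookup f) _)
    (trans (cong (lookup f′ ∘ lookup f) (Vec.lookup∘tabulate (lookup t ∘ lookup t′) x))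
    (trans (cong (lookup f′) (ft (lookup t′ x))) (ft′ x))))

inverse : ∀ {n} → Permutation n → Permutation n
inverse (perm t f tf ft) = perm f t ft tf

to-⊙ : ∀ {n} (π σ : Permutation n) x → lookup (to (π ⊙ σ)) x ≡ lookup (to π) (lookup (to σ) x)
to-⊙ π σ = Vec.lookup∘tabulate (lookup (to π) ∘ lookup (to σ))

from-⊙ : ∀ {n} (π σ : Permutation n) x → lookup (from (π ⊙ σ)) x ≡ lookup (from σ) (lookup (from π) x)
from-⊙ π σ = Vec.lookup∘tabulate (lookup (from σ) ∘ lookup (from π))

⊙-inverseʳ : ∀ {n} (π σ : Permutation n) → π ⊙ σ ⊙ inverse σ ≡ π
⊙-inverseʳ π σ = perm-cong
  (lookup-injective (λ x → trans (to-⊙ (π ⊙ σ) (inverse σ) x) (trans (to-⊙ π σ _) (cong (lookup (to π)) (to-from σ x)))))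
  (lookup-injective (λ x → trans (from-⊙ (π ⊙ σ) (inverse σ) x) (trans (cong (lookup (to σ)) (from-⊙ π σ x)) (to-from σ _))))

⊙-inverseʳ′ : ∀ {n} (π σ : Permutation n) → π ⊙ inverse σ ⊙ σ ≡ π
⊙-inverseʳ′ π σ = ⊙-inverseʳ π (inverse σ)

allVecs : ∀ n m → List (Vec (Fin n) m)
allVecs n zero    = [] ∷ []
allVecs n (suc m) = cartesianProductWith _∷_ (allFin n) (allVecs n m)

∈-allVecs : ∀ {n m} (xs : Vec (Fin n) m) → xs ∈ allVecs n m
∈-allVecs []       = here refl
∈-allVecs (x ∷ xs) = ∈-cartesianProductWith⁺ _∷_ (∈-allFin x) (∈-allVecs xs)

allVecs-unique : ∀ n m → Unique (allVecs n m)
allVecs-unique n zero    = [] ∷ []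
allVecs-unique n (suc m) = Unique.cartesianProductWith⁺ _∷_ Vec.∷-injective (Unique.allFin⁺ n) (allVecs-unique n m)

toPerm : ∀ {n} → Vec (Fin n) n × Vec (Fin n) n → Maybe (Permutation n)
toPerm (t , f) with Fin.all? (λ x → lookup t (lookup f x) Fin.≟ x) | Fin.all? (λ x → lookup f (lookup t x) Fin.≟ x)
... | yes tf | yes ft = just (perm t f tf ft)
... | _      | _      = nothing

perms : ∀ n → List (Permutation n)
perms n = mapMaybe toPerm (cartesianProduct (allVecs n n) (allVecs n n))

∈-perms : ∀ {n} (π : Permutation n) → π ∈ perms n
∈-perms π = ∈-mapMaybe⁺ toPerm (toPerm-complete π) (∈-cartesianProduct⁺ (∈-allVecs (to π)) (∈-allVecs (from π)))
  where
  toPerm-complete : ∀ {n} (π : Permutation n) → toPerm (to π , from π) ≡ just π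
  toPerm-complete (perm t f tf ft)
    with Fin.all? (λ x → lookup t (lookup f x) Fin.≟ x) | Fin.all? (λ x → lookup f (lookup t x) Fin.≟ x)
  ... | yes _  | yes _  = refl
  ... | no ¬tf | _      = ⊥-elim-irr (¬tf tf)
  ... | yes _  | no ¬ft = ⊥-elim-irr (¬ft ft)

perms-unique : ∀ n → Unique (perms n)
perms-unique n = mapMaybe-unique toPerm
  (λ p q → trans (sound p) (sym (sound q)))
  (Unique.cartesianProduct⁺ (allVecs-unique n n) (allVecs-unique n n))
  where
  sound : ∀ {p} {π : Permutation n} → toPerm p ≡ just π → p ≡ (to π , from π)
  sound {t , f} eq
    with Fin.all? (λ x → lookup t (lookup f x) Fin.≟ x) | Fin.all? (λ x → lookup f (lookup t x) Fin.≟ x) | eq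
  ... | yes _ | yes _ | refl = refl

-- The identity is listed. The number of permutations enters below only as an exponent, which can be
-- cancelled once it is nonzero.
length-perms≢0 : ∀ n → ℕ.NonZero (length (perms n))
length-perms≢0 n with perms n | ∈-perms (fromPermutation′ {n} Perm.id)
... | _ ∷ _ | _ = _

transpose-hit : ∀ {n} (i j : Fin n) → Perm.transpose i j ⟨$⟩ʳ i ≡ j
transpose-hit i j rewrite dec-true (i Fin.≟ i) refl = refl

transpose-miss : ∀ {n} (i j : Fin n) {k} → k ≢ i → k ≢ j → Perm.transpose i j ⟨$⟩ʳ k ≡ k
transpose-miss i j {k} k≢i k≢j rewrite dec-false (k Fin.≟ i) k≢i | dec-false (k Fin.≟ j) k≢j = refl

-- Two transpositions suffice: `τ` takes x to x′, and the second one takes τ y to y′. The second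
-- fixes x′, which differs from both τ y and y′.
permutation-extending : ∀ {n} {x y x′ y′ : Fin n} → x ≢ y → x′ ≢ y′ →
  Σ[ π ∈ Permutation′ n ] π ⟨$⟩ʳ x ≡ x′ × π ⟨$⟩ʳ y ≡ y′
permutation-extending {x = x} {y} {x′} {y′} x≢y x′≢y′ =
  τ ∘ₚ Perm.transpose (τ ⟨$⟩ʳ y) y′ ,
  trans (cong (Perm.transpose (τ ⟨$⟩ʳ y) y′ ⟨$⟩ʳ_) (transpose-hit x x′)) (transpose-miss (τ ⟨$⟩ʳ y) y′ x′≢τy x′≢y′) ,
  transpose-hit (τ ⟨$⟩ʳ y) y′
  where
  τ : Permutation′ _
  τ = Perm.transpose x x′
  x′≢τy : x′ ≢ τ ⟨$⟩ʳ y
  x′≢τy eq = x≢y (trans (sym (Perm.inverseˡ τ)) (trans (cong (τ ⟨$⟩ˡ_) (trans (transpose-hit x x′) eq)) (Perm.inverseˡ τ)))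

lo≢hi : ∀ {G} (f : Edge G) → lo f ≢ hi f
lo≢hi (edge x y x<y _) = Fin.<⇒≢ (recompute (x Fin.<? y) x<y)

-- By 2-transitivity on the vertices, lower endpoint can be sent to lower and higher to higher.
edge-transitive : ∀ {n} (f g : Edge (K n)) → Σ[ σ ∈ Permutation n ] onEdge (copy σ) f ≡ g
edge-transitive f g with permutation-extending (lo≢hi f) (lo≢hi g)
... | π , p , q = fromPermutation′ π , onEdge-≡ (copy (fromPermutation′ π)) f g
  (trans (Vec.lookup∘tabulate (π ⟨$⟩ʳ_) (lo f)) p)
  (trans (Vec.lookup∘tabulate (π ⟨$⟩ʳ_) (hi f)) q)

onEdge-⊙ : ∀ {n} (π σ : Permutation n) f → onEdge (copy (π ⊙ σ)) f ≡ onEdge (copy π) (onEdge (copy σ) f)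
onEdge-⊙ π σ f = trans (same (copy (π ⊙ σ)) (copy π ∘ᶜ copy σ) f (to-⊙ π σ)) (onEdge-∘ (copy π) (copy σ) f)
  where
  same : ∀ {H n} (b c : Copy H n) f → (∀ x → place b x ≡ place c x) → onEdge b f ≡ onEdge c f
  same b c (edge x y x<y _) eq = joinK-cong (λ p → Fin.<⇒≢ x<y (distinct b p)) (λ p → Fin.<⇒≢ x<y (distinct c p)) (eq x) (eq y)

onEdge-inverse : ∀ {n} (π : Permutation n) f → onEdge (copy (inverse π)) (onEdge (copy π) f) ≡ f
onEdge-inverse π f = trans (sym (onEdge-∘ (copy (inverse π)) (copy π) f))
  (onEdge-≡ (copy (inverse π) ∘ᶜ copy π) f f (from-to π (lo f)) (from-to π (hi f)))

-- Averaging an edge weight over the symmetric group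

module _ {n : ℕ} (w : Edge (K n) → ℕ) where

  orbitProduct : Edge (K n) → ℕ
  orbitProduct f = product (map (λ π → w (onEdge (copy π) f)) (perms n))

  -- If σ carries `f` to `g`, then right translation by σ permutes the factors and turns one product
  -- into the other.
  orbitProduct-const : ∀ f g → orbitProduct f ≡ orbitProduct g
  orbitProduct-const f g with edge-transitive f g
  ... | σ , refl = begin
    product (map (λ π → w (onEdge (copy π) f)) (perms n))
      ≡⟨ product-reindex (perms-unique n) ∈-perms (_⊙ σ) (_⊙ inverse σ)
           (λ π → ⊙-inverseʳ π σ) (λ π → ⊙-inverseʳ′ π σ) (λ π → w (onEdge (copy π) f)) ⟨
    product (map (λ π → w (onEdge (copy (π ⊙ σ)) f)) (perms n))
      ≡⟨ cong product (List.map-cong (λ π → cong w (onEdge-⊙ π σ f)) (perms n)) ⟩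
    product (map (λ π → w (onEdge (copy π) (onEdge (copy σ) f))) (perms n)) ∎
    where open ≡-Reasoning

  product-permuted : ∀ π → product (map (w ∘ onEdge (copy π)) (edges (K n))) ≡ product (map w (edges (K n)))
  product-permuted π = product-reindex (edges-unique (K n)) (∈-edges (K n))
    (onEdge (copy π)) (onEdge (copy (inverse π)))
    (onEdge-inverse π) (onEdge-inverse (inverse π)) w

  -- Averaging over all placements π ∘ c of H: every edge of Kₙ receives the same multiplicity.
  averaging : ∀ {H} d .{{_ : ℕ.NonZero (e H)}} → Copy H n →
    (∀ (c : Copy H n) → product (map (w ∘ onEdge c) (edges H)) ℕ.≤ d ℕ.^ e H) →
    product (map w (edges (K n))) ℕ.≤ d ℕ.^ e (K n)
  averaging {H} d c bound with edges (K n) in eq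
  -- Without edges both sides are 1. Otherwise any edge `f₀` serves as the reference for the common
  -- orbit product.
  ... | [] = ℕ.≤-refl
  ... | f₀ ∷ fs = subst (λ es → product (map w es) ℕ.≤ d ℕ.^ length es) eq goal
    where
    open ℕ.≤-Reasoning
    W N : ℕ
    W = orbitProduct f₀
    N = length (perms n)
    instance
      N≢0 : ℕ.NonZero N
      N≢0 = length-perms≢0 n

    -- The bounds for the copies π ∘ c are multiplied over all π. After the two products are
    -- exchanged, each edge of H contributes `W`.
    orbit-bound : W ℕ.^ e H ℕ.≤ (d ℕ.^ N) ℕ.^ e H
    orbit-bound = begin
      W ℕ.^ e H
        ≡⟨ product-map-const W (edges H) ⟨
      product (map (λ _ → W) (edges H))
        ≡⟨ cong product (List.map-cong (λ f → orbitProduct-const f₀ (onEdge c f)) (edges H)) ⟩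
      product (map (orbitProduct ∘ onEdge c) (edges H))
        ≡⟨ product-map-swap (λ f π → w (onEdge (copy π) (onEdge c f))) (edges H) (perms n) ⟩
      product (map (λ π → product (map (λ f → w (onEdge (copy π) (onEdge c f))) (edges H))) (perms n))
        ≡⟨ cong product (List.map-cong (λ π → cong product (List.map-cong
             (λ f → cong w (onEdge-∘ (copy π) c f)) (edges H))) (perms n)) ⟨
      product (map (λ π → product (map (w ∘ onEdge (copy π ∘ᶜ c)) (edges H))) (perms n))
        ≤⟨ product-map-mono (λ π → bound (copy π ∘ᶜ c)) (perms n) ⟩
      product (map (λ _ → d ℕ.^ e H) (perms n))
        ≡⟨ product-map-const (d ℕ.^ e H) (perms n) ⟩
      (d ℕ.^ e H) ℕ.^ N
        ≡⟨ ^-comm d (e H) N ⟩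
      (d ℕ.^ N) ℕ.^ e H ∎

    goal : product (map w (edges (K n))) ℕ.≤ d ℕ.^ e (K n)
    -- The same exchange on Kₙ itself: the N-th power of the total is a product of orbit products,
    -- each equal to `W`, and W ≤ d^N by `orbit-bound`.
    goal = ^-cancelˡ-≤ N (begin
      product (map w (edges (K n))) ℕ.^ N
        ≡⟨ product-map-const _ (perms n) ⟨
      product (map (λ _ → product (map w (edges (K n)))) (perms n))
        ≡⟨ cong product (List.map-cong product-permuted (perms n)) ⟨
      product (map (λ π → product (map (w ∘ onEdge (copy π)) (edges (K n)))) (perms n))
        ≡⟨ product-map-swap (λ f π → w (onEdge (copy π) f)) (edges (K n)) (perms n) ⟨
      product (map orbitProduct (edges (K n)))
        ≡⟨ cong product (List.map-cong (λ f → orbitProduct-const f f₀) (edges (K n))) ⟩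
      product (map (λ _ → W) (edges (K n)))
        ≡⟨ product-map-const W (edges (K n)) ⟩
      W ℕ.^ e (K n)
        ≤⟨ ℕ.^-monoˡ-≤ (e (K n)) (^-cancelˡ-≤ (e H) orbit-bound) ⟩
      (d ℕ.^ N) ℕ.^ e (K n)
        ≡⟨ ^-comm d N (e (K n)) ⟩
      (d ℕ.^ e (K n)) ℕ.^ N ∎)

-- Real logarithms

infix 4 _≤[_]_

-- The approximating terms are compared up to an explicit error k/(n+1). Such errors add up, so that
-- no ε has to be split.
record _≤[_]_ (x : ℝ) (k : ℕ) (y : ℝ) : Set where
  field at : ∀ n → seq x n ℚ.≤ seq y n ℚ.+ + k ℚ./ suc n

open _≤[_]_ using (at)

-- The threshold is taken for ε/(k+1) rather than ε/k, which covers k = 0 as well.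
≤[]⇒≤ : ∀ {x y k} → x ≤[ k ] y → x ≤ y
≤[]⇒≤ {x} {y} {k} h ε ε>0 with archimedes ((+ 1 ℚ./ suc k) ℚ.* ε) ε/k>0
  where
  ε/k>0 : 0ℚᵘ ℚ.< (+ 1 ℚ./ suc k) ℚ.* ε
  ε/k>0 = ℚ.<-respˡ-≃ (ℚ.*-zeroʳ (+ 1 ℚ./ suc k)) (ℚ.*-monoʳ-<-pos (+ 1 ℚ./ suc k) ε>0)
... | N , small = N , λ n N≤n → ℚ.≤-trans (h .at n) (ℚ.+-monoʳ-≤ (seq y n) (begin
    + k ℚ./ suc n                                      ≤⟨ frac-≤ k n (suc k) n (ℕ.*-monoˡ-≤ (suc n) (ℕ.n≤1+n k)) ⟩
    + suc k ℚ./ suc n                                  ≃⟨ ℚ.≃-sym (k*1/n n) ⟩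
    (+ suc k ℚ./ 1) ℚ.* (+ 1 ℚ./ suc n)                ≤⟨ ℚ.*-monoʳ-≤-nonNeg (+ suc k ℚ./ 1) (small n N≤n) ⟩
    (+ suc k ℚ./ 1) ℚ.* ((+ 1 ℚ./ suc k) ℚ.* ε)        ≃⟨ ℚ.≃-sym (ℚ.*-assoc (+ suc k ℚ./ 1) (+ 1 ℚ./ suc k) ε) ⟩
    (+ suc k ℚ./ 1) ℚ.* (+ 1 ℚ./ suc k) ℚ.* ε          ≃⟨ ℚ.*-congʳ {ε} (ℚ.*-inverseʳ (+ suc k ℚ./ 1)) ⟩
    ℚ.1ℚᵘ ℚ.* ε                                        ≃⟨ ℚ.*-identityˡ ε ⟩
    ε                                                  ∎))
  where
  open ℚ.≤-Reasoning
  k*1/n : ∀ n → (+ suc k ℚ./ 1) ℚ.* (+ 1 ℚ./ suc n) ℚ.≃ + suc k ℚ./ suc n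
  k*1/n n = ℚ.*≡* (cong₂ ℤ._*_ (ℤ.*-identityʳ (+ suc k)) (cong +_ (sym (ℕ.*-identityˡ (suc n)))))

0/n≃0 : ∀ d → + 0 ℚ./ suc d ℚ.≃ 0ℚᵘ
0/n≃0 d = ℚ.*≡* refl

frac-+ : ∀ j k d → (+ j ℚ./ suc d) ℚ.+ (+ k ℚ./ suc d) ℚ.≃ + (j ℕ.+ k) ℚ./ suc d
frac-+ j zero d rewrite ℕ.+-identityʳ j =
  ℚ.≃-trans (ℚ.+-congʳ (+ j ℚ./ suc d) (0/n≃0 d)) (ℚ.+-identityʳ (+ j ℚ./ suc d))
frac-+ j (suc k) d rewrite ℕ.+-suc j k = begin
  α ℚ.+ (+ suc k ℚ./ suc d)                     ≈⟨ ℚ.+-congʳ α (ℚ.≃-sym (frac-suc k d)) ⟩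
  α ℚ.+ ((+ k ℚ./ suc d) ℚ.+ (+ 1 ℚ./ suc d))   ≈⟨ ℚ.≃-sym (ℚ.+-assoc α (+ k ℚ./ suc d) (+ 1 ℚ./ suc d)) ⟩
  (α ℚ.+ (+ k ℚ./ suc d)) ℚ.+ (+ 1 ℚ./ suc d)   ≈⟨ ℚ.+-congˡ (+ 1 ℚ./ suc d) (frac-+ j k d) ⟩
  (+ (j ℕ.+ k) ℚ./ suc d) ℚ.+ (+ 1 ℚ./ suc d)   ≈⟨ frac-suc (j ℕ.+ k) d ⟩
  + suc (j ℕ.+ k) ℚ./ suc d                     ∎
  where
  open import Relation.Binary.Reasoning.Setoid ℚ.≃-setoid
  α : ℚᵘ
  α = + j ℚ./ suc d

≤[]-refl : ∀ x → x ≤[ 0 ] x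
≤[]-refl x .at n = ℚ.≤-reflexive (ℚ.≃-trans (ℚ.≃-sym (ℚ.+-identityʳ (seq x n))) (ℚ.+-congʳ (seq x n) (ℚ.≃-sym (0/n≃0 n))))

≤[]-trans : ∀ {x y z j k} → x ≤[ j ] y → y ≤[ k ] z → x ≤[ k ℕ.+ j ] z
≤[]-trans {x} {y} {z} {j} {k} h h′ .at n = begin
  seq x n                                                   ≤⟨ h .at n ⟩
  seq y n ℚ.+ + j ℚ./ suc n                                 ≤⟨ ℚ.+-monoˡ-≤ (+ j ℚ./ suc n) (h′ .at n) ⟩
  seq z n ℚ.+ + k ℚ./ suc n ℚ.+ + j ℚ./ suc n               ≃⟨ ℚ.+-assoc (seq z n) (+ k ℚ./ suc n) (+ j ℚ./ suc n) ⟩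
  seq z n ℚ.+ (+ k ℚ./ suc n ℚ.+ + j ℚ./ suc n)             ≃⟨ ℚ.+-congʳ (seq z n) (frac-+ k j n) ⟩
  seq z n ℚ.+ + (k ℕ.+ j) ℚ./ suc n                         ∎
  where open ℚ.≤-Reasoning

+-mono-≤[] : ∀ {x y u v j k} → x ≤[ j ] y → u ≤[ k ] v → x + u ≤[ j ℕ.+ k ] y + v
+-mono-≤[] {x} {y} {u} {v} {j} {k} h h′ .at n = begin
  seq x n ℚ.+ seq u n
    ≤⟨ ℚ.+-mono-≤ (h .at n) (h′ .at n) ⟩
  (seq y n ℚ.+ + j ℚ./ suc n) ℚ.+ (seq v n ℚ.+ + k ℚ./ suc n)
    ≃⟨ interchange (seq y n) (+ j ℚ./ suc n) (seq v n) (+ k ℚ./ suc n) ⟩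
  (seq y n ℚ.+ seq v n) ℚ.+ (+ j ℚ./ suc n ℚ.+ + k ℚ./ suc n)
    ≃⟨ ℚ.+-congʳ (seq y n ℚ.+ seq v n) (frac-+ j k n) ⟩
  (seq y n ℚ.+ seq v n) ℚ.+ + (j ℕ.+ k) ℚ./ suc n ∎
  where open ℚ.≤-Reasoning

recipSum-monoʳ-≤ : ∀ a {j k} → j ℕ.≤ k → recipSum a j ℚ.≤ recipSum a k
recipSum-monoʳ-≤ a {j} j≤k with ℕ.≤⇒≤′ j≤k
... | ℕ.≤′-refl = ℚ.≤-refl
... | ℕ.≤′-step {k} j≤′k = ℚ.≤-trans (recipSum-monoʳ-≤ a (ℕ.≤′⇒≤ j≤′k))
                                     (ℚ.p≤p+q (recipSum a k) (+ 1 ℚ./ suc (a ℕ.+ k)))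

-- Both Riemann sums have the same mesh, so one is an initial segment of the other and no error
-- arises.
log-mono-≤[] : ∀ {a b} .{{_ : ℕ.NonZero a}} → a ℕ.≤ b → log a ≤[ 0 ] log b
log-mono-≤[] {suc p} {suc q} (ℕ.s≤s p≤q) .at n = ℚ.≤-trans
  (recipSum-monoʳ-≤ (suc n) (ℕ.*-monoˡ-≤ (suc n) p≤q))
  (≤[]-refl (log (suc q)) .at n)

-- With mesh 1/(n+1), the sum for log (ab) is the sum for log a followed by the sum for
-- log b with the finer mesh 1/(a(n+1)).
log-*-split : ∀ p q n → seq (log (suc p ℕ.* suc q)) n ℚ.≃
                        seq (log (suc p)) n ℚ.+ seq (log (suc q)) (n ℕ.+ p ℕ.* suc n)
log-*-split p q n = begin
  recipSum S ((q ℕ.+ p ℕ.* suc q) ℕ.* S)                ≡⟨ cong (recipSum S) (rearrange p q S) ⟩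
  recipSum S (p ℕ.* S ℕ.+ q ℕ.* (suc p ℕ.* S))          ≈⟨ recipSum-+ S (p ℕ.* S) (q ℕ.* (suc p ℕ.* S)) ⟩
  recipSum S (p ℕ.* S) ℚ.+ recipSum (S ℕ.+ p ℕ.* S) (q ℕ.* (suc p ℕ.* S)) ∎
  where
  open import Relation.Binary.Reasoning.Setoid ℚ.≃-setoid
  S : ℕ
  S = suc n
  rearrange : ∀ p q s → (q ℕ.+ p ℕ.* suc q) ℕ.* s ≡ p ℕ.* s ℕ.+ q ℕ.* (suc p ℕ.* s)
  rearrange = solve 3 (λ p q s → (q :+ p :* (con 1 :+ q)) :* s := p :* s :+ q :* ((con 1 :+ p) :* s)) refl

-- Splitting leaves the sum for log b with the finer mesh; `log-modulus` returns it to mesh 1/(n+1)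
-- at a cost of 1/(n+1).
log-*-≤ : ∀ a b .{{_ : ℕ.NonZero a}} .{{_ : ℕ.NonZero b}} → log (a ℕ.* b) ≤[ 1 ] log a + log b
log-*-≤ (suc p) (suc q) .at n = begin
  seq (log (suc p ℕ.* suc q)) n                       ≃⟨ log-*-split p q n ⟩
  A ℚ.+ seq (log (suc q)) (n ℕ.+ p ℕ.* suc n)         ≤⟨ ℚ.+-monoʳ-≤ A (log-modulus q (n ℕ.+ p ℕ.* suc n) n) ⟩
  A ℚ.+ (B ℚ.+ + 1 ℚ./ suc n)                         ≃⟨ ℚ.≃-sym (ℚ.+-assoc A B (+ 1 ℚ./ suc n)) ⟩
  A ℚ.+ B ℚ.+ + 1 ℚ./ suc n                           ∎
  where
  open ℚ.≤-Reasoning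
  A B : ℚᵘ
  A = seq (log (suc p)) n
  B = seq (log (suc q)) n

log-*-≥ : ∀ a b .{{_ : ℕ.NonZero a}} .{{_ : ℕ.NonZero b}} → log a + log b ≤[ 1 ] log (a ℕ.* b)
log-*-≥ (suc p) (suc q) .at n = begin
  A ℚ.+ seq (log (suc q)) n             ≤⟨ ℚ.+-monoʳ-≤ A (log-modulus q n m) ⟩
  -- Since m+1 = a(n+1), the error 1/(m+1) is at most 1/(n+1).
  A ℚ.+ (B ℚ.+ + 1 ℚ./ suc m)           ≤⟨ ℚ.+-monoʳ-≤ A (ℚ.+-monoʳ-≤ B (frac-≤ 1 m 1 n (ℕ.*-monoʳ-≤ 1 (ℕ.s≤s (ℕ.m≤m+n n (p ℕ.* suc n)))))) ⟩
  A ℚ.+ (B ℚ.+ + 1 ℚ./ suc n)           ≃⟨ ℚ.≃-sym (ℚ.+-assoc A B (+ 1 ℚ./ suc n)) ⟩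
  A ℚ.+ B ℚ.+ + 1 ℚ./ suc n             ≃⟨ ℚ.+-congˡ (+ 1 ℚ./ suc n) (ℚ.≃-sym (log-*-split p q n)) ⟩
  seq (log (suc p ℕ.* suc q)) n ℚ.+ + 1 ℚ./ suc n ∎
  where
  open ℚ.≤-Reasoning
  m : ℕ
  m = n ℕ.+ p ℕ.* suc n
  A B : ℚᵘ
  A = seq (log (suc p)) n
  B = seq (log (suc q)) m

module _ {A : Set} (f : A → ℕ) (f≢0 : ∀ x → ℕ.NonZero (f x)) where

  -- Every multiplication costs one unit of error. Factors are nonzero, as additivity would fail
  -- under the convention log 0 = 0.
  log-product-≥ : ∀ xs → foldr _+_ 0ℝ (map (λ x → log (f x)) xs) ≤[ length xs ] log (product (map f xs))
  -- The terms of `log 1` are empty sums and hence the same as those of `0ℝ`.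
  log-product-≥ [] .at = ≤[]-refl 0ℝ .at
  log-product-≥ (x ∷ xs) = ≤[]-trans
    (+-mono-≤[] (≤[]-refl (log (f x))) (log-product-≥ xs))
    (log-*-≥ (f x) (product (map f xs)) {{f≢0 x}} {{product-map≢0 f f≢0 xs}})

  log-product-≤ : ∀ xs → log (product (map f xs)) ≤[ length xs ] foldr _+_ 0ℝ (map (λ x → log (f x)) xs)
  log-product-≤ [] .at = ≤[]-refl 0ℝ .at
  log-product-≤ (x ∷ xs) = subst (λ k → log (f x ℕ.* product (map f xs)) ≤[ k ] log (f x) + foldr _+_ 0ℝ (map (λ x → log (f x)) xs))
    (ℕ.+-comm (length xs) 1)
    (≤[]-trans
      (log-*-≤ (f x) (product (map f xs)) {{f≢0 x}} {{product-map≢0 f f≢0 xs}})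
      (+-mono-≤[] (≤[]-refl (log (f x))) (log-product-≤ xs)))

foldr-const : ∀ {A : Set} x (xs : List A) n →
  seq (foldr _+_ 0ℝ (map (λ _ → x) xs)) n ℚ.≃ (+ length xs ℚ./ 1) ℚ.* seq x n
foldr-const x [] n = ℚ.≃-sym (ℚ.*-zeroˡ (seq x n))
foldr-const x (_ ∷ xs) n = begin
  q ℚ.+ seq (foldr _+_ 0ℝ (map (λ _ → x) xs)) n   ≈⟨ ℚ.+-congʳ q (foldr-const x xs n) ⟩
  q ℚ.+ L ℚ.* q                                   ≈⟨ ℚ.+-comm q (L ℚ.* q) ⟩
  L ℚ.* q ℚ.+ q                                   ≈⟨ ℚ.+-congʳ (L ℚ.* q) (ℚ.≃-sym (ℚ.*-identityˡ q)) ⟩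
  L ℚ.* q ℚ.+ ℚ.1ℚᵘ ℚ.* q                         ≈⟨ ℚ.≃-sym (ℚ.*-distribʳ-+ q L ℚ.1ℚᵘ) ⟩
  (L ℚ.+ ℚ.1ℚᵘ) ℚ.* q                             ≈⟨ ℚ.*-congʳ {q} (frac-suc (length xs) 0) ⟩
  (+ suc (length xs) ℚ./ 1) ℚ.* q                 ∎
  where
  open import Relation.Binary.Reasoning.Setoid ℚ.≃-setoid
  q L : ℚᵘ
  q = seq x n
  L = + length xs ℚ./ 1

foldr-const-÷ : ∀ {A : Set} x (xs : List A) {m} .{{_ : ℕ.NonZero m}} → length xs ≡ m → ∀ n →
  seq (foldr _+_ 0ℝ (map (λ _ → x) xs) ÷ m) n ℚ.≃ seq x n
foldr-const-÷ x xs {suc k} eq n = begin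
  seq (foldr _+_ 0ℝ (map (λ _ → x) xs)) n ℚ.* c   ≈⟨ ℚ.*-congʳ {c} (foldr-const x xs n) ⟩
  (+ length xs ℚ./ 1) ℚ.* q ℚ.* c                 ≡⟨ cong (λ l → (+ l ℚ./ 1) ℚ.* q ℚ.* c) eq ⟩
  L ℚ.* q ℚ.* c                                   ≈⟨ ℚ.*-congʳ {c} (ℚ.*-comm L q) ⟩
  q ℚ.* L ℚ.* c                                   ≈⟨ ℚ.*-assoc q L c ⟩
  q ℚ.* (L ℚ.* c)                                 ≈⟨ ℚ.*-congˡ {q} (ℚ.*-inverseʳ L) ⟩
  q ℚ.* ℚ.1ℚᵘ                                     ≈⟨ ℚ.*-identityʳ q ⟩
  q                                               ∎
  where
  open import Relation.Binary.Reasoning.Setoid ℚ.≃-setoid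
  q L c : ℚᵘ
  q = seq x n
  L = + suc k ℚ./ 1
  c = + 1 ℚ./ suc k

-- Representatives and palette sizes

∣p∪q∣≤∣p∣+∣q∣ : ∀ {n} (p q : Subset n) → ∣ p ∪ q ∣ ℕ.≤ ∣ p ∣ ℕ.+ ∣ q ∣
∣p∪q∣≤∣p∣+∣q∣ []            []            = ℕ.z≤n
∣p∪q∣≤∣p∣+∣q∣ (outside ∷ p) (outside ∷ q) = ∣p∪q∣≤∣p∣+∣q∣ p q
∣p∪q∣≤∣p∣+∣q∣ (outside ∷ p) (inside ∷ q)  =
  ℕ.≤-trans (ℕ.s≤s (∣p∪q∣≤∣p∣+∣q∣ p q)) (ℕ.≤-reflexive (sym (ℕ.+-suc ∣ p ∣ ∣ q ∣)))
∣p∪q∣≤∣p∣+∣q∣ (inside ∷ p)  (y ∷ q)       =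
  ℕ.s≤s (ℕ.≤-trans (∣p∪q∣≤∣p∣+∣q∣ p q) (ℕ.+-monoʳ-≤ ∣ p ∣ (Subset.∣p∣≤∣x∷p∣ y q)))

fromList : ∀ {n} → List (Fin n) → Subset n
fromList = foldr (λ x p → ⁅ x ⁆ ∪ p) ⊥

∈-fromList : ∀ {n} {x : Fin n} {xs} → x ∈ xs → x Subset.∈ fromList xs
∈-fromList {xs = y ∷ xs} (here refl)  = Subset.x∈p∪q⁺ (inj₁ (Subset.x∈⁅x⁆ y))
∈-fromList {xs = y ∷ xs} (there x∈xs) = Subset.x∈p∪q⁺ {p = ⁅ y ⁆} (inj₂ (∈-fromList x∈xs))

∣fromList∣≤length : ∀ {n} (xs : List (Fin n)) → ∣ fromList xs ∣ ℕ.≤ length xs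
∣fromList∣≤length {n} [] = ℕ.≤-reflexive (Subset.∣⊥∣≡0 n)
∣fromList∣≤length (x ∷ xs) = ℕ.≤-trans (∣p∪q∣≤∣p∣+∣q∣ ⁅ x ⁆ (fromList xs))
  (ℕ.+-mono-≤ (ℕ.≤-reflexive (Subset.∣⁅x⁆∣≡1 x)) (∣fromList∣≤length xs))

-- Pigeonhole: otherwise the entries of `xs` would cover `p`.
∃-fresh : ∀ {n} (p : Subset n) (xs : List (Fin n)) → length xs ℕ.< ∣ p ∣ → ∃[ x ] (x Subset.∈ p × x ∉ xs)
∃-fresh p xs small with Fin.any? (λ x → (x Subset.∈? p) ×-dec ¬? (_∈?_ Fin._≟_ x xs))
... | yes fresh = fresh
... | no ¬fresh = contradiction small (ℕ.≤⇒≯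
  (ℕ.≤-trans (Subset.p⊆q⇒∣p∣≤∣q∣ covered) (∣fromList∣≤length xs)))
  where
  covered : p ⊆ fromList xs
  covered {x} x∈p = ∈-fromList (decidable-stable (_∈?_ Fin._≟_ x xs) (λ x∉xs → ¬fresh (x , x∈p , x∉xs)))

unique⊆⇒length≤ : ∀ {n} {p : Subset n} {xs} → Unique xs → All (Subset._∈ p) xs → length xs ℕ.≤ ∣ p ∣
unique⊆⇒length≤ [] [] = ℕ.z≤n
unique⊆⇒length≤ {p = p} {x ∷ xs} (x∉ ∷ u) (x∈p ∷ xs⊆p) = ℕ.≤-trans
  (ℕ.s≤s (unique⊆⇒length≤ u (All.zipWith (λ (x≢y , y∈p) → Subset.x∈p∧x≢y⇒x∈p-y y∈p (x≢y ∘ sym)) (x∉ , xs⊆p))))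
  (Subset.x∈p⇒∣p-x∣<∣p∣ x∈p)

subset-of-size : ∀ {m n} → m ℕ.≤ n → Σ[ p ∈ Subset n ] ∣ p ∣ ≡ m
subset-of-size {n = n} ℕ.z≤n = ⊥ , Subset.∣⊥∣≡0 n
subset-of-size (ℕ.s≤s m≤n) with subset-of-size m≤n
... | p , eq = inside ∷ p , cong suc eq

nonempty⇒∣∣≢0 : ∀ {n} {p : Subset n} → Nonempty p → ℕ.NonZero ∣ p ∣
nonempty⇒∣∣≢0 {p = p} (x , x∈p) = ℕ.>-nonZero (ℕ.≤-trans (ℕ.s≤s ℕ.z≤n) (Subset.x∈p⇒∣p-x∣<∣p∣ x∈p))

module _ {I : Set} (_≟_ : DecidableEquality I) {ℓ : ℕ} (A : I → Subset ℓ) (A≢∅ : ∀ i → Nonempty (A i)) where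

  -- The choice is a function on all of `I`, but only its values on `xs` are constrained.
  PartialSDR : List I → Set
  PartialSDR xs = Σ[ a ∈ (I → Fin ℓ) ]
    (∀ {x} → x ∈ xs → a x Subset.∈ A x) × (∀ {x y} → x ∈ xs → y ∈ xs → a x ≡ a y → x ≡ y)

  -- The bound that holds when k+1 of the sets have size at most k.
  SmallProduct : List I → Set
  SmallProduct xs = ∃[ k ] ∃[ r ] length xs ≡ suc k ℕ.+ r ×
    product (map (∣_∣ ∘ A) xs) ℕ.≤ k ℕ.^ suc k ℕ.* ℓ ℕ.^ r

  extend : ∀ x xs → x ∉ xs → length xs ℕ.< ∣ A x ∣ → PartialSDR xs → PartialSDR (x ∷ xs)
  extend x xs x∉xs large (a , a∈A , a-inj)
    with ∃-fresh (A x) (map a xs) (subst (ℕ._< ∣ A x ∣) (sym (List.length-map a xs)) large)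
  ... | c , c∈Ax , c∉ = a′ , a′∈A , a′-inj
    where
    a′ : I → Fin ℓ
    a′ y with y ≟ x
    ... | yes _ = c
    ... | no  _ = a y
    a′-x : a′ x ≡ c
    a′-x with x ≟ x
    ... | yes _  = refl
    ... | no x≢x = contradiction refl x≢x
    a′-xs : ∀ {y} → y ∈ xs → a′ y ≡ a y
    a′-xs {y} y∈xs with y ≟ x
    ... | yes refl = contradiction y∈xs x∉xs
    ... | no _     = refl
    a′∈A : ∀ {y} → y ∈ x ∷ xs → a′ y Subset.∈ A y
    a′∈A (here refl)      = subst (Subset._∈ A x) (sym a′-x) c∈Ax
    a′∈A {y} (there y∈xs) = subst (Subset._∈ A y) (sym (a′-xs y∈xs)) (a∈A y∈xs)
    c≢ : ∀ {y} → y ∈ xs → a′ x ≢ a′ y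
    c≢ {y} y∈xs eq = c∉ (subst (_∈ map a xs) (trans (sym (a′-xs y∈xs)) (trans (sym eq) a′-x)) (∈-map⁺ a y∈xs))
    a′-inj : ∀ {y z} → y ∈ x ∷ xs → z ∈ x ∷ xs → a′ y ≡ a′ z → y ≡ z
    a′-inj (here refl) (here refl) _ = refl
    a′-inj (here refl) (there z∈xs) eq = contradiction eq (c≢ z∈xs)
    a′-inj (there y∈xs) (here refl) eq = contradiction (sym eq) (c≢ y∈xs)
    a′-inj (there y∈xs) (there z∈xs) eq = a-inj y∈xs z∈xs (trans (sym (a′-xs y∈xs)) (trans eq (a′-xs z∈xs)))

  -- Sizes decrease along the list and the tail is treated first, so representatives are chosen for
  -- the smallest sets first. A set larger than the number of earlier choices always has a fresh
  -- element.
  greedy : ∀ {xs} → Unique xs → AllPairs (λ x y → ∣ A y ∣ ℕ.≤ ∣ A x ∣) xs → PartialSDR xs ⊎ SmallProduct xs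
  greedy [] [] = inj₁ (proj₁ ∘ A≢∅ , (λ ()) , λ ())
  greedy {x ∷ xs} (x∉ ∷ u) (≤x ∷ s) with greedy u s | length xs ℕ.<? ∣ A x ∣
  -- Once the choice has failed, each further set contributes at most a factor ℓ.
  ... | inj₂ (k , r , eq , le) | _ = inj₂ (k , suc r , trans (cong suc eq) (sym (ℕ.+-suc (suc k) r)) , (begin
      ∣ A x ∣ ℕ.* product (map (∣_∣ ∘ A) xs)   ≤⟨ ℕ.*-mono-≤ (Subset.∣p∣≤n (A x)) le ⟩
      ℓ ℕ.* (k ℕ.^ suc k ℕ.* ℓ ℕ.^ r)          ≡⟨ ℕ.*-comm ℓ _ ⟩
      k ℕ.^ suc k ℕ.* ℓ ℕ.^ r ℕ.* ℓ            ≡⟨ ℕ.*-assoc (k ℕ.^ suc k) (ℓ ℕ.^ r) ℓ ⟩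
      k ℕ.^ suc k ℕ.* (ℓ ℕ.^ r ℕ.* ℓ)          ≡⟨ cong (k ℕ.^ suc k ℕ.*_) (ℕ.*-comm (ℓ ℕ.^ r) ℓ) ⟩
      k ℕ.^ suc k ℕ.* ℓ ℕ.^ suc r              ∎))
    where open ℕ.≤-Reasoning
  ... | inj₁ sdr | yes large = inj₁ (extend x xs (λ x∈xs → All.lookup x∉ x∈xs refl) large sdr)
  -- The choice fails here with k = `length xs`: the current set has size at most k, and the k sets
  -- in the tail are no larger.
  ... | inj₁ _   | no ¬large = inj₂ (length xs , 0 , cong suc (sym (ℕ.+-identityʳ (length xs))) ,
    ℕ.≤-trans (product-map-≤^ (small ∷ All.map (λ le → ℕ.≤-trans le small) ≤x)) (ℕ.≤-reflexive (sym (ℕ.*-identityʳ _))))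
    where
    small : ∣ A x ∣ ℕ.≤ length xs
    small = ℕ.≮⇒≥ ¬large

  ¬SDR⇒product-≤ : ∀ {xs} → Unique xs → (∀ x → x ∈ xs) → ¬ HasSDR A →
    ∃[ i ] ∃[ r ] length xs ≡ 2 ℕ.+ i ℕ.+ r × product (map (∣_∣ ∘ A) xs) ℕ.≤ suc i ℕ.^ (2 ℕ.+ i) ℕ.* ℓ ℕ.^ r
  ¬SDR⇒product-≤ {xs} u ∈xs ¬sdr = from-greedy
    (greedy (Unique-resp-↭ (setoid I) (↭⇒↭ₛ (↭-sym ys↭xs)) u) (Sorted⇒AllPairs totalOrder (sort-↗ bySize xs)))
    where
    bySize : DecTotalOrder _ _ _
    -- The order of sizes is reversed to put the smallest sets at the end, where `greedy` starts.
    bySize = On.decTotalOrder (Flip.decTotalOrder ℕ.≤-decTotalOrder) (∣_∣ ∘ A)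
    open DecTotalOrder bySize using (totalOrder)
    ys : List I
    ys = sort bySize xs
    ys↭xs : ys ↭ xs
    ys↭xs = sort-↭ bySize xs
    ∈ys : ∀ x → x ∈ ys
    ∈ys x = ↭.∈-resp-↭ (↭-sym ys↭xs) (∈xs x)
    from-greedy : PartialSDR ys ⊎ SmallProduct ys →
      ∃[ i ] ∃[ r ] length xs ≡ 2 ℕ.+ i ℕ.+ r × product (map (∣_∣ ∘ A) xs) ℕ.≤ suc i ℕ.^ (2 ℕ.+ i) ℕ.* ℓ ℕ.^ r
    from-greedy (inj₁ (a , a∈A , a-inj)) =
      contradiction (a , (λ x → a∈A (∈ys x)) , λ {x} {y} → a-inj (∈ys x) (∈ys y)) ¬sdr
    -- k = 0 would force the product of the nonzero sizes to be 0.
    from-greedy (inj₂ (zero , _ , _ , le)) =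
      contradiction le (ℕ.<⇒≱ (ℕ.>-nonZero⁻¹ _ {{product-map≢0 (∣_∣ ∘ A) (nonempty⇒∣∣≢0 ∘ A≢∅) ys}}))
    from-greedy (inj₂ (suc i , r , eq , le)) = i , r , trans (sym (↭.↭-length ys↭xs)) eq ,
      ℕ.≤-trans (ℕ.≤-reflexive (sym (product-↭ (↭.map⁺ (∣_∣ ∘ A) ys↭xs)))) le

-- Templates without SDR and the value of λ

edge-≟ : ∀ {G} → DecidableEquality (Edge G)
edge-≟ (edge x y _ _) (edge x′ y′ _ _) with x Fin.≟ x′ | y Fin.≟ y′
... | yes refl | yes refl = yes refl
... | no x≢x′  | _        = no λ { refl → x≢x′ refl }
... | yes _    | no y≢y′  = no λ { refl → y≢y′ refl }

-- Here d = b+1 and k = i+1, so the number r of remaining palettes is b-i = d-k, as the convexity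
-- bound requires.
SDRFree⇒product-≤ : ∀ {H n ℓ b} .{{_ : ℕ.NonZero b}} → e H ≡ 2 ℕ.+ b → ℓ ℕ.^ b ℕ.≤ suc b ℕ.^ (2 ℕ.+ b) →
  (P : Template n ℓ) → SDRFree H P → (c : Copy H n) →
  product (map (λ f → ∣ palette P (onEdge c f) ∣) (edges H)) ℕ.≤ suc b ℕ.^ e H
SDRFree⇒product-≤ {H} {ℓ = ℓ} {b} eH ℓ^b≤ P free c with ¬SDR⇒product-≤ edge-≟ (palette P ∘ onEdge c)
  (nonempty P ∘ onEdge c) (edges-unique H) (∈-edges H) (free c)
... | i , r , eq , le = begin
  product (map (λ f → ∣ palette P (onEdge c f) ∣) (edges H))   ≤⟨ le ⟩
  suc i ℕ.^ (2 ℕ.+ i) ℕ.* ℓ ℕ.^ r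
    ≡⟨ cong (λ s → suc i ℕ.^ (2 ℕ.+ i) ℕ.* ℓ ℕ.^ s) (trans (sym (ℕ.m+n∸m≡n i r)) (cong (_∸ i) (sym b≡))) ⟩
  suc i ℕ.^ (2 ℕ.+ i) ℕ.* ℓ ℕ.^ (b ∸ i)
    ≤⟨ k^[k+1]ℓ^[d-k]-bound ℓ (ℕ.≤-trans (ℕ.m≤m+n i r) (ℕ.≤-reflexive (sym b≡))) ℓ^b≤ ⟩
  suc b ℕ.^ (2 ℕ.+ b)                                          ≡⟨ cong (suc b ℕ.^_) eH ⟨
  suc b ℕ.^ e H                                                ∎
  where
  open ℕ.≤-Reasoning
  b≡ : b ≡ i ℕ.+ r
  b≡ = ℕ.suc-injective (ℕ.suc-injective (trans (sym eH) eq))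

constant : ∀ {n ℓ} (p : Subset ℓ) → Nonempty p → Template n ℓ
constant p p≢∅ .palette _  = p
constant p p≢∅ .nonempty _ = p≢∅

-- An SDR would place e(H) distinct colours in `p`.
constant-SDRFree : ∀ H {n ℓ} (p : Subset ℓ) (p≢∅ : Nonempty p) → ∣ p ∣ ℕ.< e H → SDRFree H (constant {n} p p≢∅)
constant-SDRFree H p p≢∅ ∣p∣<e c (a , a∈p , a-inj) = ℕ.<⇒≱ ∣p∣<e (ℕ.≤-trans
  (ℕ.≤-reflexive (sym (List.length-map a (edges H))))
  (unique⊆⇒length≤ (Unique.map⁺ a-inj (edges-unique H)) (All.map⁺ (All.universal a∈p (edges H)))))

inject : ∀ {H n} → v H ℕ.≤ n → Copy H n
inject v≤n .place      = λ x → Fin.inject≤ x v≤n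
inject v≤n .distinct {x} {y} = Fin.inject≤-injective v≤n v≤n x y

≈-refl : ∀ x → x ≈ x
≈-refl x ε ε>0 = 0 , λ n _ → ∣-∣≤ {seq x n} (x≤x+ε n) (x≤x+ε n)
  where
  x≤x+ε : ∀ n → seq x n ℚ.≤ seq x n ℚ.+ ε
  x≤x+ε n = ℚ.≤-trans (ℚ.≤-reflexive (ℚ.≃-sym (ℚ.+-identityʳ (seq x n)))) (ℚ.+-monoʳ-≤ (seq x n) (ℚ.<⇒≤ ε>0))

nonZero-∈ : ∀ {A : Set} {x : A} {xs} → x ∈ xs → ℕ.NonZero (length xs)
nonZero-∈ {xs = _ ∷ _} _ = _

-- This keeps the average over the edges of Kₙ away from the convention x ÷ 0 = 0.
e-K≢0 : ∀ {H n} .{{_ : ℕ.NonZero (e H)}} → Copy H n → ℕ.NonZero (e (K n))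
e-K≢0 {H} {n} c with edges H
... | f ∷ _ = nonZero-∈ (∈-edges (K n) (onEdge c f))

-- Passing from the integer products to sums of logarithms costs e(Kₙ) units of error on each side,
-- which vanish in the limit.
logWeight-maximal : ∀ {n ℓ} (P : Template n ℓ) {p : Subset ℓ} (p≢∅ : Nonempty p) →
  product (map (∣_∣ ∘ palette P) (edges (K n))) ℕ.≤ ∣ p ∣ ℕ.^ e (K n) →
  logWeight P ≤ logWeight (constant {n} p p≢∅)
logWeight-maximal {n} P {p} p≢∅ h = ≤[]⇒≤ (≤[]-trans (≤[]-trans
  (log-product-≥ (∣_∣ ∘ palette P) sizes≢0 (edges (K n)))
  (log-mono-≤[] {{product-map≢0 (∣_∣ ∘ palette P) sizes≢0 (edges (K n))}}
    (ℕ.≤-trans h (ℕ.≤-reflexive (sym (product-map-const ∣ p ∣ (edges (K n))))))))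
  (log-product-≤ (λ _ → ∣ p ∣) (λ _ → nonempty⇒∣∣≢0 p≢∅) (edges (K n))))
  where
  sizes≢0 : ∀ f → ℕ.NonZero ∣ palette P f ∣
  sizes≢0 = nonempty⇒∣∣≢0 ∘ nonempty P

-- Here b = e(H) - 2. The averages agree term by term with log (b+1) for every n, so the infimum is
-- that of a constant sequence.
isLambda : ∀ H b .{{_ : ℕ.NonZero b}} → e H ≡ 2 ℕ.+ b → ∀ ℓ → 2 ℕ.+ b ℕ.≤ ℓ →
  ℓ ℕ.^ b ℕ.≤ suc b ℕ.^ (2 ℕ.+ b) → IsLambda H ℓ (log (suc b))
isLambda H b eH ℓ b<ℓ ℓ^b≤ with subset-of-size (ℕ.≤-trans (ℕ.n≤1+n (suc b)) b<ℓ)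
... | p , ∣p∣≡ with ∃-fresh p [] (ℕ.≤-trans (ℕ.s≤s ℕ.z≤n) (ℕ.≤-reflexive (sym ∣p∣≡)))
... | x , x∈p , _ = (λ n → logWeight (P n)) , isMaximum , lower , greatest
  where
  instance
    eH≢0 : ℕ.NonZero (e H)
    eH≢0 = subst ℕ.NonZero (sym eH) _
  P : ∀ n → Template n ℓ
  P n = constant p (x , x∈p)
  isMaximum : ∀ n → v H ℕ.≤ n → IsExLog n H ℓ (logWeight (P n))
  isMaximum n v≤n =
    ((P n , constant-SDRFree H p (x , x∈p) (ℕ.≤-reflexive (trans (cong suc ∣p∣≡) (sym eH)))) , ≈-refl (logWeight (P n))) ,
    λ (Q , free) → logWeight-maximal Q (x , x∈p) (ℕ.≤-trans
      (averaging (∣_∣ ∘ palette Q) (suc b) (inject v≤n) (SDRFree⇒product-≤ eH ℓ^b≤ Q free))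
      (ℕ.≤-reflexive (cong (ℕ._^ e (K n)) (sym ∣p∣≡))))
  average : ∀ n → v H ℕ.≤ n → ∀ m → seq (logWeight (P n) ÷ (n C 2)) m ℚ.≃ seq (log (suc b)) m
  average n v≤n m = subst (λ s → seq (logWeight (P n) ÷ (n C 2)) m ℚ.≃ seq (log s) m) ∣p∣≡
    (foldr-const-÷ (log ∣ p ∣) (edges (K n)) {{subst ℕ.NonZero (e-K n) (e-K≢0 (inject v≤n))}} (e-K n) m)
  lower : ∀ ((n , _) : Σ[ n ∈ ℕ ] v H ℕ.≤ n) → log (suc b) ≤ logWeight (P n) ÷ (n C 2)
  lower (n , v≤n) = ≤[]⇒≤ {log (suc b)} {logWeight (P n) ÷ (n C 2)} {0} (record { at = λ m → ℚ.≤-trans (≤[]-refl (log (suc b)) .at m)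
    (ℚ.≤-reflexive (ℚ.+-congˡ _ (ℚ.≃-sym (average n v≤n m)))) })
  greatest : ∀ z → (∀ ((n , _) : Σ[ n ∈ ℕ ] v H ℕ.≤ n) → z ≤ logWeight (P n) ÷ (n C 2)) → z ≤ log (suc b)
  -- One admissible n is enough, and n = v(H) is one.
  greatest z z≤ ε ε>0 with z≤ (v H , ℕ.≤-refl) ε ε>0
  ... | N , h = N , λ m N≤m → ℚ.≤-trans (h m N≤m) (ℚ.≤-reflexive (ℚ.+-congˡ ε (average (v H) ℕ.≤-refl m)))

corollary3p3 : (H : Graph) → NoIsolatedVertices H → NonMatching H → 3 ℕ.≤ e H →
    (ℓ : ℕ) → e H ℕ.≤ ℓ → fromℕ ℓ ≤ power (e H ∸ 1) (e H) (e H ∸ 2) →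
    IsLambda H ℓ (log (e H ∸ 1))
corollary3p3 H _ _ 3≤e ℓ e≤ℓ ℓ≤ with e H in eq
-- Writing e(H) = r+3 makes the root index e(H) - 2 a successor, so `power` is not in its default
-- case.
corollary3p3 H _ _ (ℕ.s≤s (ℕ.s≤s (ℕ.s≤s _))) ℓ e≤ℓ ℓ≤ | suc (suc (suc r)) =
  isLambda H (suc r) eq ℓ e≤ℓ (≤power⇒^≤ ℓ (2 ℕ.+ r) (3 ℕ.+ r) r ℓ≤)
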